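{- Let $G=(V,E)$ be a graph on $n$ vertices with $m$ edges which is a disjoint union of $p$ complete graphs $G_1,\dots,G_p$ (its components), so that $\sum_{i=1}^p |V(G_i)|=n$ and $m=\sum_{i=1}^p\binom{|V(G_i)|}{2}$. Then $G$ is a Largest Eigenvalue Local Minimizer (LELM). In other words, $\lambda_1(G)$ is locally minimized, i.e. minimized with respect to one edge reconnects, one edge removals and one edge additions: $\lambda_1(G)\leqslant\lambda_1(G')$ for every simple graph $G'$ obtained from $G$ by a one edge reconnect, a one edge removal or a one edge addition. Further, $\lambda_1(G)=\max_{i\in\{1,\dots,p\}}|V(G_i)|$.
   Context: All graphs are simple, undirected and unweighted (no self loops, no multiple edges). The Laplacian of $G$ is $L(G)=D(G)-A(G)$, where $D(G)$ is the diagonal matrix of vertex degrees and $A(G)$ is the adjacency matrix; $\lambda_1(G)$ denotes the largest eigenvalue of $L(G)$. One edge reconnect: given a simple graph $G_0=(V,E_0)$ with $|V|=n$, $|E_0|=m$, a simple graph $G_1=(V,E_1)$ is a one-edge reconnect of $G_0$ if one or both of the end nodes of exactly one edge differ from those of $G_0$; that is, $G_1$ is obtained from $G_0$ by removing one edge and adding one different edge between two vertices not adjacent in $G_0$ (so $|E_1|=m$ and $\operatorname{rank}(L(G_1)-L(G_0))=2$). One edge addition: adding one edge to the graph while keeping it simple. One edge removal: deleting one edge of the graph. In all cases the vertex set is unchanged. A graph $G_0$ is a Largest Eigenvalue Local Minimizer (LELM) if $\lambda_1(G_0)$ is least among all simple graphs obtained from $G_0$ by either a one edge reconnect or a one edge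 addition, i.e. $\lambda_1(G_0)\leqslant\lambda_1(G')$ for each such graph $G'$.
   Formalization: The edge-removal claim is stated only for m ≠ 1 (for K₂ plus isolated vertices, removing the only edge lowers λ₁ from 2 to 0), and λ₁(G) = max|V(G_i)| only for m ≠ 0 (an edgeless graph has λ₁ = 0 but maximum component size 1). -}

module Defs where

open import Level using (0ℓ)
open import Algebra.Bundles using (RawMonoid)
open import Data.Bool.Base using (if_then_else_; _∧_)
open import Data.Fin.Base using (Fin; _<_)
import Data.Fin.Properties as Fin
open import Data.Fin.Subset using (Subset; ∣_∣)
open import Data.Integer.Base as ℤ using (ℤ; +_)
open import Data.Nat.Base as ℕ using (ℕ)
import Data.Nat.Properties as ℕ
open import Data.Product.Base using (∃; ∃₂; _×_; _,_; proj₁; proj₂)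
open import Data.Rational.Base as ℚ using (ℚ; 0ℚ; 1ℚ; ½)
import Data.Rational.Properties as ℚ
open import Data.Rational.Solver using (module +-*-Solver)
open import Data.Sum.Base using (_⊎_)
open import Data.Vec.Base using (tabulate)
open import Data.Vec.Functional using (Vector; foldr)
open import Function.Bundles using (_⇔_)
open import Function.Definitions using (Surjective)
open import Relation.Binary.Core using (Rel)
open import Relation.Binary.Definitions using (Symmetric; Irreflexive; Decidable)
open import Relation.Binary.PropositionalEquality
  using (_≡_; _≢_; refl; sym; trans; cong; cong₂; subst)
open import Relation.Nullary.Decidable.Core using (does)
open import Relation.Nullary.Negation.Core using (¬_)
import Algebra.Definitions.RawMonoid as RawMonoidSum

IsCauchy : (ℕ → ℚ) → Set
IsCauchy x = ∀ ε → 0ℚ ℚ.< ε →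
  ∃ λ N → ∀ m n → N ℕ.≤ m → N ℕ.≤ n → ℚ.∣ x m ℚ.- x n ∣ ℚ.< ε

-- Equality of reals is _≃_, not propositional equality.
record ℝ : Set where
  constructor mkℝ
  field
    seq    : ℕ → ℚ
    cauchy : IsCauchy seq

open ℝ public

infix 4 _≃_ _≤_

_≃_ : Rel ℝ 0ℓ
x ≃ y = ∀ ε → 0ℚ ℚ.< ε →
  ∃ λ N → ∀ n → N ℕ.≤ n → ℚ.∣ seq x n ℚ.- seq y n ∣ ℚ.< ε

_≤_ : Rel ℝ 0ℓ
x ≤ y = ∀ ε → 0ℚ ℚ.< ε →
  ∃ λ N → ∀ n → N ℕ.≤ n → seq x n ℚ.- seq y n ℚ.< ε

abstract
  half-pos : ∀ {ε} → 0ℚ ℚ.< ε → 0ℚ ℚ.< ½ ℚ.* ε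
  half-pos {ε} 0<ε = subst (ℚ._< ½ ℚ.* ε) (ℚ.*-zeroʳ ½) (ℚ.*-monoʳ-<-pos ½ 0<ε)

  halves : ∀ ε → ½ ℚ.* ε ℚ.+ ½ ℚ.* ε ≡ ε
  halves ε = trans (sym (ℚ.*-distribʳ-+ ε ½ ½)) (ℚ.*-identityˡ ε)

  +-cauchy : ∀ {x y} → IsCauchy x → IsCauchy y → IsCauchy (λ n → x n ℚ.+ y n)
  +-cauchy {x} {y} cx cy ε 0<ε
    with M , hx ← cx (½ ℚ.* ε) (half-pos 0<ε)
       | N , hy ← cy (½ ℚ.* ε) (half-pos 0<ε)
    = M ℕ.⊔ N , λ m n m≥ n≥ → begin-strict
        ℚ.∣ (x m ℚ.+ y m) ℚ.- (x n ℚ.+ y n) ∣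
          ≡⟨ cong ℚ.∣_∣ (rearrange (x m) (y m) (x n) (y n)) ⟩
        ℚ.∣ (x m ℚ.- x n) ℚ.+ (y m ℚ.- y n) ∣
          ≤⟨ ℚ.∣p+q∣≤∣p∣+∣q∣ (x m ℚ.- x n) (y m ℚ.- y n) ⟩
        ℚ.∣ x m ℚ.- x n ∣ ℚ.+ ℚ.∣ y m ℚ.- y n ∣
          <⟨ ℚ.+-mono-< (hx m n (ℕ.m⊔n≤o⇒m≤o M N m≥) (ℕ.m⊔n≤o⇒m≤o M N n≥))
                        (hy m n (ℕ.m⊔n≤o⇒n≤o M N m≥) (ℕ.m⊔n≤o⇒n≤o M N n≥)) ⟩
        ½ ℚ.* ε ℚ.+ ½ ℚ.* ε
          ≡⟨ halves ε ⟩
        ε ∎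
    where
    open ℚ.≤-Reasoning
    rearrange : ∀ a b c d → (a ℚ.+ b) ℚ.- (c ℚ.+ d) ≡ (a ℚ.- c) ℚ.+ (b ℚ.- d)
    rearrange = solve 4 (λ a b c d → (a :+ b) :- (c :+ d) := (a :- c) :+ (b :- d)) refl
      where open +-*-Solver

  eventuallyBounded : ∀ {x} → IsCauchy x →
    ∃ λ B → 0ℚ ℚ.< B × ∃ λ N → ∀ n → N ℕ.≤ n → ℚ.∣ x n ∣ ℚ.≤ B
  eventuallyBounded {x} cx with N , h ← cx 1ℚ (ℚ.positive⁻¹ 1ℚ)
    = 1ℚ ℚ.+ ℚ.∣ x N ∣
    , ℚ.+-mono-<-≤ (ℚ.positive⁻¹ 1ℚ) (ℚ.0≤∣p∣ (x N))
    , N , λ n n≥ → begin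
        ℚ.∣ x n ∣                             ≡⟨ cong ℚ.∣_∣ (split (x n) (x N)) ⟩
        ℚ.∣ (x n ℚ.- x N) ℚ.+ x N ∣           ≤⟨ ℚ.∣p+q∣≤∣p∣+∣q∣ (x n ℚ.- x N) (x N) ⟩
        ℚ.∣ x n ℚ.- x N ∣ ℚ.+ ℚ.∣ x N ∣       ≤⟨ ℚ.+-monoˡ-≤ ℚ.∣ x N ∣
                                                  (ℚ.<⇒≤ (h n N n≥ ℕ.≤-refl)) ⟩
        1ℚ ℚ.+ ℚ.∣ x N ∣                      ∎
    where
    open ℚ.≤-Reasoning
    split : ∀ a b → a ≡ (a ℚ.- b) ℚ.+ b
    split = solve 2 (λ a b → a := (a :- b) :+ b) refl
      where open +-*-Solver

  quotient : ∀ {B ε} → 0ℚ ℚ.< B → 0ℚ ℚ.< ε → ∃ λ δ → 0ℚ ℚ.< δ × B ℚ.* δ ≡ ε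
  quotient {B} {ε} 0<B 0<ε = δ , 0<δ , B*δ≡ε
    where
    instance
      B-pos : ℚ.Positive B
      B-pos = ℚ.positive 0<B
      B-nonZero : ℚ.NonZero B
      B-nonZero = ℚ.pos⇒nonZero B
      1/B-pos : ℚ.Positive (ℚ.1/ B)
      1/B-pos = ℚ.1/pos⇒pos B
    δ : ℚ
    δ = ℚ.1/ B ℚ.* ε
    0<δ : 0ℚ ℚ.< δ
    0<δ = subst (ℚ._< δ) (ℚ.*-zeroʳ (ℚ.1/ B)) (ℚ.*-monoʳ-<-pos (ℚ.1/ B) 0<ε)
    B*δ≡ε : B ℚ.* δ ≡ ε
    B*δ≡ε = trans (sym (ℚ.*-assoc B (ℚ.1/ B) ε))
              (trans (cong (ℚ._* ε) (ℚ.*-inverseʳ B)) (ℚ.*-identityˡ ε))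

  ∣*∣-bound : ∀ p q {B δ} → 0ℚ ℚ.< B → ℚ.∣ p ∣ ℚ.≤ B → ℚ.∣ q ∣ ℚ.< δ →
              ℚ.∣ p ℚ.* q ∣ ℚ.< B ℚ.* δ
  ∣*∣-bound p q {B} {δ} 0<B p≤B q<δ = begin-strict
    ℚ.∣ p ℚ.* q ∣          ≡⟨ ℚ.∣p*q∣≡∣p∣*∣q∣ p q ⟩
    ℚ.∣ p ∣ ℚ.* ℚ.∣ q ∣    ≤⟨ ℚ.*-monoʳ-≤-nonNeg ℚ.∣ q ∣ {{ℚ.∣-∣-nonNeg q}} p≤B ⟩
    B ℚ.* ℚ.∣ q ∣          <⟨ ℚ.*-monoʳ-<-pos B {{ℚ.positive 0<B}} q<δ ⟩
    B ℚ.* δ                ∎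
    where open ℚ.≤-Reasoning

  product-difference : ∀ a b c d →
    a ℚ.* b ℚ.- c ℚ.* d ≡ a ℚ.* (b ℚ.- d) ℚ.+ d ℚ.* (a ℚ.- c)
  product-difference = solve 4 (λ a b c d →
    a :* b :- c :* d := a :* (b :- d) :+ d :* (a :- c)) refl
    where open +-*-Solver

  product-estimate : ∀ a b c d {B C δ η ε} → 0ℚ ℚ.< B → 0ℚ ℚ.< C →
    B ℚ.* δ ≡ ½ ℚ.* ε → C ℚ.* η ≡ ½ ℚ.* ε →
    ℚ.∣ a ∣ ℚ.≤ B → ℚ.∣ b ℚ.- d ∣ ℚ.< δ → ℚ.∣ d ∣ ℚ.≤ C → ℚ.∣ a ℚ.- c ∣ ℚ.< η →
    ℚ.∣ a ℚ.* b ℚ.- c ℚ.* d ∣ ℚ.< ε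
  product-estimate a b c d {B} {C} {δ} {η} {ε} 0<B 0<C Bδ Cη a≤ b-d< d≤ a-c< =
    begin-strict
      ℚ.∣ a ℚ.* b ℚ.- c ℚ.* d ∣
        ≡⟨ cong ℚ.∣_∣ (product-difference a b c d) ⟩
      ℚ.∣ a ℚ.* (b ℚ.- d) ℚ.+ d ℚ.* (a ℚ.- c) ∣
        ≤⟨ ℚ.∣p+q∣≤∣p∣+∣q∣ (a ℚ.* (b ℚ.- d)) (d ℚ.* (a ℚ.- c)) ⟩
      ℚ.∣ a ℚ.* (b ℚ.- d) ∣ ℚ.+ ℚ.∣ d ℚ.* (a ℚ.- c) ∣
        <⟨ ℚ.+-mono-< (∣*∣-bound a (b ℚ.- d) 0<B a≤ b-d<)
                      (∣*∣-bound d (a ℚ.- c) 0<C d≤ a-c<) ⟩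
      B ℚ.* δ ℚ.+ C ℚ.* η
        ≡⟨ cong₂ ℚ._+_ Bδ Cη ⟩
      ½ ℚ.* ε ℚ.+ ½ ℚ.* ε
        ≡⟨ halves ε ⟩
      ε ∎
    where open ℚ.≤-Reasoning

  *-cauchy : ∀ {x y} → IsCauchy x → IsCauchy y → IsCauchy (λ n → x n ℚ.* y n)
  *-cauchy {x} {y} cx cy ε 0<ε =
    let B , 0<B , K , x≤B = eventuallyBounded cx
        C , 0<C , L , y≤C = eventuallyBounded cy
        δ , 0<δ , Bδ = quotient 0<B (half-pos 0<ε)
        η , 0<η , Cη = quotient 0<C (half-pos 0<ε)
        M , hx = cx η 0<η
        N , hy = cy δ 0<δ
    in (K ℕ.⊔ L) ℕ.⊔ (M ℕ.⊔ N) , λ m n m≥ n≥ →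
      let m≥KL = ℕ.m⊔n≤o⇒m≤o (K ℕ.⊔ L) (M ℕ.⊔ N) m≥
          n≥KL = ℕ.m⊔n≤o⇒m≤o (K ℕ.⊔ L) (M ℕ.⊔ N) n≥
          m≥MN = ℕ.m⊔n≤o⇒n≤o (K ℕ.⊔ L) (M ℕ.⊔ N) m≥
          n≥MN = ℕ.m⊔n≤o⇒n≤o (K ℕ.⊔ L) (M ℕ.⊔ N) n≥
      in product-estimate (x m) (y m) (x n) (y n) 0<B 0<C Bδ Cη
           (x≤B m (ℕ.m⊔n≤o⇒m≤o K L m≥KL))
           (hy m n (ℕ.m⊔n≤o⇒n≤o M N m≥MN) (ℕ.m⊔n≤o⇒n≤o M N n≥MN))
           (y≤C n (ℕ.m⊔n≤o⇒n≤o K L n≥KL))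
           (hx m n (ℕ.m⊔n≤o⇒m≤o M N m≥MN) (ℕ.m⊔n≤o⇒m≤o M N n≥MN))

  const-cauchy : ∀ q → IsCauchy (λ _ → q)
  const-cauchy q ε 0<ε = 0 , λ _ _ _ _ →
    subst (ℚ._< ε) (sym (cong ℚ.∣_∣ (ℚ.+-inverseʳ q))) 0<ε

infixl 6 _+_
infixl 7 _*_

_+_ : ℝ → ℝ → ℝ
x + y = mkℝ (λ n → seq x n ℚ.+ seq y n)
            (+-cauchy {seq x} {seq y} (cauchy x) (cauchy y))

_*_ : ℝ → ℝ → ℝ
x * y = mkℝ (λ n → seq x n ℚ.* seq y n)
            (*-cauchy {seq x} {seq y} (cauchy x) (cauchy y))

fromℚ : ℚ → ℝ
fromℚ q = mkℝ (λ _ → q) (const-cauchy q)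

fromℤ : ℤ → ℝ
fromℤ z = fromℚ (z ℚ./ 1)

0ℝ : ℝ
0ℝ = fromℚ 0ℚ

+-0-rawMonoid : RawMonoid 0ℓ 0ℓ
+-0-rawMonoid = record { _≈_ = _≃_ ; _∙_ = _+_ ; ε = 0ℝ }

open RawMonoidSum +-0-rawMonoid public using () renaming (sum to sumℝ)
open RawMonoidSum ℕ.+-0-rawMonoid public using () renaming (sum to sumℕ)

Matrix : Set → ℕ → Set
Matrix A n = Fin n → Fin n → A

_*ᵥ_ : ∀ {n} → Matrix ℤ n → Vector ℝ n → Vector ℝ n
(M *ᵥ v) i = sumℝ (λ j → fromℤ (M i j) * v j)

IsEigenvalue : ∀ {n} → Matrix ℤ n → ℝ → Set
IsEigenvalue M μ = ∃ λ v → ¬ (∀ i → v i ≃ 0ℝ) × (∀ i → (M *ᵥ v) i ≃ μ * v i)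

IsLargestEigenvalue : ∀ {n} → Matrix ℤ n → ℝ → Set
IsLargestEigenvalue M μ = IsEigenvalue M μ × (∀ ν → IsEigenvalue M ν → ν ≤ μ)

record Graph (n : ℕ) : Set₁ where
  infix 4 _~_ _~?_
  field
    _~_      : Rel (Fin n) 0ℓ
    ~-sym    : Symmetric _~_
    ~-irrefl : Irreflexive _≡_ _~_
    _~?_     : Decidable _~_

  degree : Fin n → ℕ
  degree u = ∣ tabulate (λ v → does (u ~? v)) ∣

  -- Each edge is counted once, at its smaller end.
  edgeCount : ℕ
  edgeCount = sumℕ λ u → ∣ tabulate (λ v → does (u Fin.<? v) ∧ does (u ~? v)) ∣

  degreeMatrix : Matrix ℤ n
  degreeMatrix u v = if does (u Fin.≟ v) then + degree u else + 0

  adjacencyMatrix : Matrix ℤ n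
  adjacencyMatrix u v = if does (u ~? v) then + 1 else + 0

  laplacian : Matrix ℤ n
  laplacian u v = degreeMatrix u v ℤ.- adjacencyMatrix u v

open Graph public using (edgeCount; laplacian)

-- λ₁(G) is handled relationally: as a function G ↦ λ₁(G) it would need the
-- spectral theorem for its definition.
Isλ₁ : ∀ {n} → Graph n → ℝ → Set
Isλ₁ G μ = IsLargestEigenvalue (laplacian G) μ

infix 4 _λ₁≤_

_λ₁≤_ : ∀ {n} → Graph n → Graph n → Set
G λ₁≤ H = ∀ μ ν → Isλ₁ G μ → Isλ₁ H ν → μ ≤ ν

-- {x , y} = {u , v} as unordered pairs.
SamePair : ∀ {n} → (u v x y : Fin n) → Set
SamePair u v x y = (x ≡ u × y ≡ v) ⊎ (x ≡ v × y ≡ u)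

OneEdgeAddition : ∀ {n} → Graph n → Graph n → Set
OneEdgeAddition G H = ∃₂ λ u v → u ≢ v × ¬ (u G.~ v) ×
  (∀ x y → x H.~ y ⇔ (x G.~ y ⊎ SamePair u v x y))
  where module G = Graph G; module H = Graph H

OneEdgeRemoval : ∀ {n} → Graph n → Graph n → Set
OneEdgeRemoval G H = ∃₂ λ a b → a G.~ b ×
  (∀ x y → x H.~ y ⇔ (x G.~ y × ¬ SamePair a b x y))
  where module G = Graph G; module H = Graph H

-- Replace the edge ab by uv; uv differs from ab since it is not an edge of G.
OneEdgeReconnect : ∀ {n} → Graph n → Graph n → Set
OneEdgeReconnect G H = ∃₂ λ a b → ∃₂ λ u v → a G.~ b × u ≢ v × ¬ (u G.~ v) ×
  (∀ x y → x H.~ y ⇔ ((x G.~ y × ¬ SamePair a b x y) ⊎ SamePair u v x y))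
  where module G = Graph G; module H = Graph H

LELM : ∀ {n} → Graph n → Set₁
LELM G = ∀ H → OneEdgeReconnect G H ⊎ OneEdgeAddition G H → G λ₁≤ H

-- The components are the fibres of c, which are nonempty by surjectivity.
IsDisjointUnionOfCompletes : ∀ {n p} → Graph n → (Fin n → Fin p) → Set
IsDisjointUnionOfCompletes G c =
  Surjective _≡_ _≡_ c × (∀ u v → u G.~ v ⇔ (u ≢ v × c u ≡ c v))
  where module G = Graph G

componentSize : ∀ {n p} → (Fin n → Fin p) → Fin p → ℕ
componentSize c i = ∣ tabulate (λ v → does (c v Fin.≟ i)) ∣

maximum : ∀ {p} → Vector ℕ p → ℕ
maximum = foldr ℕ._⊔_ 0

{-# OPTIONS --safe #-}
module Submission where

-- The Laplacian of G acts on x as (L x) i = Σ (x i - x j) over the j in the clique of i, so on a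
-- clique of size s an eigenvector has eigenvalue 0 or s, and e_x - e_z has eigenvalue s when x and
-- z lie in that clique. Removing the edge ab and adding the edge uv changes L x by
-- - (x a - x b)(e_a - e_b) + (x u - x v)(e_u - e_v). A vector that is supported on cliques of the
-- maximal size m, sums to zero on each of them and satisfies x a = x b and x u = x v therefore
-- remains an eigenvector for m. If m ≥ 3, such a vector is missing only for m = 3, when ab is removed
-- from a clique {a , b , z} that uv attaches to a clique of size 1 or 2; the resulting component is
-- K₁,₃, P₄, P₅ or a spider, each with an explicit eigenvalue above 3 (irrational for the last three, hence constructed by
-- bisection). For m ≤ 2 the component of uv is K₂, P₃ or P₄.
-- An edge addition is the case a = b, an edge removal the case u = v.

-- The largest eigenvalue of the modified graph H is only given, never computed, and reals are
-- Cauchy sequences without a decidable order. So no Rayleigh quotient or interlacing enters: it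
-- suffices that every eigenvalue of G is at most m and that some explicit eigenvalue of H is at
-- least m. Both claims reduce to rational arithmetic at each index of the sequences, where an
-- eigenvalue equation says that a rational sequence tends to 0. Why m = 3 is the hard case: the
-- vectors summing to zero on a clique of size m form a space of dimension m - 1. The condition x a
-- = x b costs one dimension, and if u lies in the clique and v outside it, x u = x v = 0 costs
-- another. A non-zero vector always survives for m ≥ 4, but for m = 3 nothing need be left, and an
-- eigenvector that reaches into the clique of v is required.

open import Defs renaming (_≤_ to _≤ᵣ_; _+_ to _+ᵣ_; _*_ to _*ᵣ_)
open import Algebra.Bundles using (CommutativeRing)
open import Data.Bool.Base using (Bool; true; false; if_then_else_; _∧_)
open import Data.Bool.Properties using (∧-zeroʳ)
open import Data.Fin.Base as Fin using (Fin; zero; suc; splitAt; join)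
open import Data.Fin.Patterns using (0F; 1F; 2F; 3F; 4F)
open import Data.Fin.Properties as Fin using (_≟_; any?; join-splitAt; splitAt-join)
open import Data.Fin.Subset as Subset using (Subset; ∣_∣; _∈_; _∉_; inside; outside)
import Data.Fin.Subset.Properties as Subset
open import Data.Integer.Base as ℤ using (ℤ; +_)
import Data.Integer.Properties as ℤ
open import Data.Nat.Base as ℕ using (ℕ)
import Data.Nat.Coprimality as Coprime
import Data.Nat.Properties as ℕ
open import Data.Product.Base using (∃; _×_; _,_; proj₁; proj₂)
open import Data.Rational.Base as ℚ
  using (ℚ; mkℚ; 0ℚ; 1ℚ; ½; _+_; _*_; _-_; -_; _≤_; _<_; _/_; toℚᵘ; ↥_; ↧_)
import Data.Rational.Properties as ℚ
open import Data.Rational.Solver using (module +-*-Solver)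
open import Data.Rational.Unnormalised.Base as ℚᵘ using (mkℚᵘ; *≡*)
import Data.Rational.Unnormalised.Properties as ℚᵘ
open import Data.Sum.Base as Sum using (_⊎_; inj₁; inj₂; [_,_]′)
open import Data.Vec.Base using (Vec; []; _∷_; lookup; tabulate; there)
open import Data.Vec.Functional using (foldr)
import Data.Vec.Properties as Vec
open import Data.Vec.Relation.Unary.All as All using (All; []; _∷_)
import Data.Vec.Relation.Unary.All.Properties as All
open import Data.Vec.Relation.Unary.AllPairs using ([]; _∷_)
open import Data.Vec.Relation.Unary.Unique.Propositional using (Unique)
open import Data.Vec.Relation.Unary.Unique.Propositional.Properties using (lookup-injective)
open import Function.Base using (_∘_; const)
open import Function.Bundles using (_⇔_; Equivalence; mk⇔)
open import Relation.Binary.Definitions using (tri<; tri≈; tri>)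
open import Relation.Binary.PropositionalEquality hiding (J)
open import Relation.Nullary using (¬_; Dec; yes; no; does; contradiction)
open import Relation.Nullary.Decidable
  using (dec-true; dec-false; from-yes; does-⇔; ¬?; _×-dec_; _⊎-dec_)
open import Algebra.Properties.Semiring.Sum (CommutativeRing.semiring ℚ.+-*-commutativeRing)
  using (sum; sum-cong-≗; ∑-distrib-+; ∑-comm; *-distribʳ-sum; sum-replicate-zero)

open +-*-Solver

-- Finite sums of rationals

𝟙 : Bool → ℚ
𝟙 b = if b then 1ℚ else 0ℚ

δ : ∀ {n} → Fin n → Fin n → ℚ
δ i j = 𝟙 (does (i ≟ j))

δ-refl : ∀ {n} (i : Fin n) → δ i i ≡ 1ℚ
δ-refl i = cong 𝟙 (dec-true (i ≟ i) refl)

δ-≢ : ∀ {n} {i j : Fin n} → i ≢ j → δ i j ≡ 0ℚ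
δ-≢ {i = i} {j} i≢j = cong 𝟙 (dec-false (i ≟ j) i≢j)

/1-homo-+ : ∀ a b → (a ℤ.+ b) / 1 ≡ a / 1 + b / 1
/1-homo-+ a b = ℚ.toℚᵘ-injective (begin-equality
  toℚᵘ ((a ℤ.+ b) / 1)            ≃⟨ ℚ.toℚᵘ-fromℚᵘ (mkℚᵘ (a ℤ.+ b) 0) ⟩
  mkℚᵘ (a ℤ.+ b) 0                ≃⟨ *≡* (cong (ℤ._* + 1) (sym (cong₂ ℤ._+_ (ℤ.*-identityʳ a) (ℤ.*-identityʳ b)))) ⟩
  mkℚᵘ a 0 ℚᵘ.+ mkℚᵘ b 0          ≃⟨ ℚᵘ.+-cong (ℚ.toℚᵘ-fromℚᵘ (mkℚᵘ a 0)) (ℚ.toℚᵘ-fromℚᵘ (mkℚᵘ b 0)) ⟨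
  toℚᵘ (a / 1) ℚᵘ.+ toℚᵘ (b / 1)  ≃⟨ ℚ.toℚᵘ-homo-+ (a / 1) (b / 1) ⟨
  toℚᵘ (a / 1 + b / 1)            ∎)
  where open ℚᵘ.≤-Reasoning

sum-≡0 : ∀ {n} (f : Fin n → ℚ) → (∀ j → f j ≡ 0ℚ) → sum f ≡ 0ℚ
sum-≡0 {n} f f≡0 = trans (sum-cong-≗ f≡0) (sum-replicate-zero n)

sum-minus : ∀ {n} (f g : Fin n → ℚ) → sum (λ j → f j - g j) ≡ sum f - sum g
sum-minus {ℕ.zero}  f g = refl
sum-minus {ℕ.suc n} f g = trans (cong (_+_ (f zero - g zero)) (sum-minus (f ∘ suc) (g ∘ suc)))
  (solve 4 (λ a b c d → (a :- b) :+ (c :- d) := (a :+ c) :- (b :+ d)) refl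
    (f zero) (g zero) (sum (f ∘ suc)) (sum (g ∘ suc)))

sum-δ : ∀ {n} (a : Fin n) (f : Fin n → ℚ) → sum (λ j → δ a j * f j) ≡ f a
sum-δ zero f = trans
  (cong₂ _+_ (ℚ.*-identityˡ (f zero)) (sum-≡0 _ (λ j → ℚ.*-zeroˡ (f (suc j)))))
  (ℚ.+-identityʳ (f zero))
sum-δ (suc a) f = trans
  (cong₂ _+_ (ℚ.*-zeroˡ (f zero)) (sum-δ a (f ∘ suc)))
  (ℚ.+-identityˡ (f (suc a)))

sum-𝟙 : ∀ {n} (P : Fin n → Bool) → sum (λ j → 𝟙 (P j)) ≡ + ∣ tabulate P ∣ / 1
sum-𝟙 {ℕ.zero}  P = refl
sum-𝟙 {ℕ.suc n} P with P zero
... | true  = trans (cong (_+_ 1ℚ) (sum-𝟙 (P ∘ suc))) (sym (/1-homo-+ (+ 1) (+ ∣ tabulate (P ∘ suc) ∣)))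
... | false = trans (ℚ.+-identityˡ _) (sum-𝟙 (P ∘ suc))

seq-sumℝ : ∀ {n} (f : Fin n → ℝ) k → seq (sumℝ f) k ≡ sum (λ i → seq (f i) k)
seq-sumℝ {ℕ.zero}  f k = refl
seq-sumℝ {ℕ.suc n} f k = cong (_+_ (seq (f zero) k)) (seq-sumℝ (f ∘ suc) k)

-- The Laplacian of a modified union of cliques

𝟙-yes : ∀ {P : Set} (P? : Dec P) → P → 𝟙 (does P?) ≡ 1ℚ
𝟙-yes P? p = cong 𝟙 (dec-true P? p)

𝟙-no : ∀ {P : Set} (P? : Dec P) → ¬ P → 𝟙 (does P?) ≡ 0ℚ
𝟙-no P? ¬p = cong 𝟙 (dec-false P? ¬p)

module _ {n} (H : Graph n) where
  private module H = Graph H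

  laplacian-/1 : ∀ i j → laplacian H i j / 1 ≡ δ i j * (+ H.degree i / 1) - 𝟙 (does (i H.~? j))
  laplacian-/1 i j with does (i ≟ j) | does (i H.~? j)
  ... | true  | true  = trans (/1-homo-+ (+ H.degree i) (ℤ.- (+ 1))) (cong (_- 1ℚ) (sym (ℚ.*-identityˡ (+ H.degree i / 1))))
  ... | true  | false = trans (/1-homo-+ (+ H.degree i) (+ 0)) (cong (_- 0ℚ) (sym (ℚ.*-identityˡ (+ H.degree i / 1))))
  ... | false | true  = cong (_- 1ℚ) (sym (ℚ.*-zeroˡ (+ H.degree i / 1)))
  ... | false | false = cong (_- 0ℚ) (sym (ℚ.*-zeroˡ (+ H.degree i / 1)))

  -- The degree is the row sum of the adjacency indicator, so the diagonal entry is absorbed and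
  -- only differences remain. The operations on `ℝ` act index by index, hence the equality is exact
  -- at each k.
  seq-laplacian : ∀ (v : Fin n → ℝ) i k →
    seq ((laplacian H *ᵥ v) i) k ≡
    sum (λ j → 𝟙 (does (i H.~? j)) * (seq (v i) k - seq (v j) k))
  seq-laplacian v i k = begin
    seq ((laplacian H *ᵥ v) i) k
      ≡⟨ seq-sumℝ (λ j → fromℤ (laplacian H i j) *ᵣ v j) k ⟩
    sum (λ j → laplacian H i j / 1 * x j)
      ≡⟨ sum-cong-≗ (λ j → trans (cong (_* x j) (laplacian-/1 i j))
           (solve 4 (λ e d a y → (e :* d :- a) :* y := e :* (d :* y) :- a :* y) refl
             (δ i j) d (A j) (x j))) ⟩
    sum (λ j → δ i j * (d * x j) - A j * x j)
      ≡⟨ sum-minus (λ j → δ i j * (d * x j)) (λ j → A j * x j) ⟩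
    sum (λ j → δ i j * (d * x j)) - sum (λ j → A j * x j)
      ≡⟨ cong (_- sum (λ j → A j * x j)) (trans (sum-δ i (λ j → d * x j))
           (trans (cong (_* x i) (sym (sum-𝟙 (λ j → does (i H.~? j))))) (*-distribʳ-sum (x i) A))) ⟩
    sum (λ j → A j * x i) - sum (λ j → A j * x j)
      ≡⟨ sum-minus (λ j → A j * x i) (λ j → A j * x j) ⟨
    sum (λ j → A j * x i - A j * x j)
      ≡⟨ sum-cong-≗ (λ j → solve 3 (λ a y z → a :* y :- a :* z := a :* (y :- z)) refl (A j) (x i) (x j)) ⟩
    sum (λ j → A j * (x i - x j)) ∎
    where
    open ≡-Reasoning
    x : Fin n → ℚ
    x j = seq (v j) k
    d = + H.degree i / 1
    A : Fin n → ℚ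
    A j = 𝟙 (does (i H.~? j))

-- The Laplacian of the single edge ab, the rank-one map x ↦ ⟨e_a - e_b , x⟩ (e_a - e_b); it is zero
-- when a = b.
edgeTerm : ∀ {n} (a b : Fin n) (x : Fin n → ℚ) → Fin n → ℚ
edgeTerm a b x i = (x a - x b) * (δ a i - δ b i)

surgeryOp : ∀ {n p} (c : Fin n → Fin p) (a b u v : Fin n) (x : Fin n → ℚ) → Fin n → ℚ
surgeryOp c a b u v x i =
  sum (λ j → δ (c j) (c i) * (x i - x j)) - edgeTerm a b x i + edgeTerm u v x i

-- The alternative u ≡ v stands for adding no edge.
Joins : ∀ {n p} (c : Fin n → Fin p) (u v : Fin n) → Set
Joins c u v = u ≡ v ⊎ c u ≢ c v

-- The factor x ≢ y makes degenerate pairs harmless: `SamePair a a` and `SamePair u u` hold only on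
-- the diagonal.
IsSurgery : ∀ {n p} (c : Fin n → Fin p) (a b u v : Fin n) → Graph n → Set
IsSurgery c a b u v H = ∀ x y → x H.~ y ⇔
  (x ≢ y × ((c x ≡ c y × ¬ SamePair a b x y) ⊎ SamePair u v x y))
  where module H = Graph H

-- Off the diagonal this is the adjacency matrix of the edge ab. At a = b = i = j it takes the value
-- 2, so the value 1 is claimed only for i ≢ j.
pairIndicator : ∀ {n} (a b i j : Fin n) → ℚ
pairIndicator a b i j = δ a i * δ b j + δ b i * δ a j

module _ {n} (a b : Fin n) where

  δ-* : ∀ (x : Fin n → ℚ) i → δ a i * x i ≡ δ a i * x a
  δ-* x i with a ≟ i
  ... | yes refl = refl
  ... | no  _    = trans (ℚ.*-zeroˡ (x i)) (sym (ℚ.*-zeroˡ (x a)))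

  pairIndicator-yes : ∀ {i j} → i ≢ j → SamePair a b i j → pairIndicator a b i j ≡ 1ℚ
  pairIndicator-yes i≢j (inj₁ (refl , refl))
    rewrite δ-refl a | δ-refl b | δ-≢ (≢-sym i≢j) | δ-≢ i≢j = refl
  pairIndicator-yes i≢j (inj₂ (refl , refl))
    rewrite δ-refl a | δ-refl b | δ-≢ (≢-sym i≢j) | δ-≢ i≢j = refl

  pairIndicator-no : ∀ {i j} → ¬ SamePair a b i j → pairIndicator a b i j ≡ 0ℚ
  pairIndicator-no {i} {j} ¬sp with a ≟ i | b ≟ j | b ≟ i | a ≟ j
  ... | yes p | yes q | _     | _     = contradiction (inj₁ (sym p , sym q)) ¬sp
  ... | _     | _     | yes p | yes q = contradiction (inj₂ (sym p , sym q)) ¬sp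
  ... | no  _ | yes _ | no  _ | yes _ = refl
  ... | no  _ | yes _ | no  _ | no  _ = refl
  ... | no  _ | yes _ | yes _ | no  _ = refl
  ... | no  _ | no  _ | no  _ | yes _ = refl
  ... | no  _ | no  _ | no  _ | no  _ = refl
  ... | no  _ | no  _ | yes _ | no  _ = refl
  ... | yes _ | no  _ | no  _ | yes _ = refl
  ... | yes _ | no  _ | no  _ | no  _ = refl
  ... | yes _ | no  _ | yes _ | no  _ = refl

module _ {n} (a b : Fin n) where

  sum-pairIndicator : ∀ (x : Fin n → ℚ) i →
    sum (λ j → pairIndicator a b i j * (x i - x j)) ≡ edgeTerm a b x i
  sum-pairIndicator x i = begin
    sum (λ j → pairIndicator a b i j * (x i - x j))
      ≡⟨ sum-cong-≗ (λ j → solve 6 (λ ai bj bi aj y z →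
           (ai :* bj :+ bi :* aj) :* (y :- z) :=
           bj :* (ai :* (y :- z)) :+ aj :* (bi :* (y :- z))) refl
           (δ a i) (δ b j) (δ b i) (δ a j) (x i) (x j)) ⟩
    sum (λ j → δ b j * (δ a i * (x i - x j)) + δ a j * (δ b i * (x i - x j)))
      ≡⟨ ∑-distrib-+ (λ j → δ b j * (δ a i * (x i - x j))) (λ j → δ a j * (δ b i * (x i - x j))) ⟩
    sum (λ j → δ b j * (δ a i * (x i - x j))) + sum (λ j → δ a j * (δ b i * (x i - x j)))
      ≡⟨ cong₂ _+_ (sum-δ b _) (sum-δ a _) ⟩
    δ a i * (x i - x b) + δ b i * (x i - x a)
      ≡⟨ solve 5 (λ ai bi xi xa xb → ai :* (xi :- xb) :+ bi :* (xi :- xa) :=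
           (ai :* xi :- ai :* xb) :+ (bi :* xi :- bi :* xa)) refl
           (δ a i) (δ b i) (x i) (x a) (x b) ⟩
    (δ a i * x i - δ a i * x b) + (δ b i * x i - δ b i * x a)
      ≡⟨ cong₂ _+_ (cong (_- δ a i * x b) (δ-* a b x i)) (cong (_- δ b i * x a) (δ-* b a x i)) ⟩
    (δ a i * x a - δ a i * x b) + (δ b i * x b - δ b i * x a)
      ≡⟨ solve 4 (λ ai bi xa xb → (ai :* xa :- ai :* xb) :+ (bi :* xb :- bi :* xa) :=
           (xa :- xb) :* (ai :- bi)) refl (δ a i) (δ b i) (x a) (x b) ⟩
    (x a - x b) * (δ a i - δ b i) ∎
    where open ≡-Reasoning

samePair? : ∀ {n} (a b x y : Fin n) → Dec (SamePair a b x y)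
samePair? a b x y = (x ≟ a ×-dec y ≟ b) ⊎-dec (x ≟ b ×-dec y ≟ a)

module _ {n p} {c : Fin n → Fin p} {a b u v : Fin n} {H : Graph n}
         (ca≡cb : c a ≡ c b) (joins : Joins c u v) (surgery : IsSurgery c a b u v H) where
  private
    module H = Graph H

    samePair-class : ∀ {i j} → SamePair a b i j → c j ≡ c i
    samePair-class (inj₁ (refl , refl)) = sym ca≡cb
    samePair-class (inj₂ (refl , refl)) = ca≡cb

    joined-class : ∀ {i j} → i ≢ j → SamePair u v i j → c j ≢ c i
    joined-class i≢j (inj₁ (refl , refl)) cj≡ci = [ i≢j , (λ cu≢cv → cu≢cv (sym cj≡ci)) ]′ joins
    joined-class i≢j (inj₂ (refl , refl)) cj≡ci = [ ≢-sym i≢j , (λ cu≢cv → cu≢cv cj≡ci) ]′ joins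

    -- A removed pair lies inside one class and an added pair never does, so the two corrections act
    -- on disjoint entries: 1 - 1 on the first, 0 + 1 on the second.
    entry : ∀ {i j} → i ≢ j →
      𝟙 (does (i H.~? j)) ≡ δ (c j) (c i) - pairIndicator a b i j + pairIndicator u v i j
    entry {i} {j} i≢j with samePair? a b i j | samePair? u v i j | c j ≟ c i
    ... | yes sp | yes sp′ | _         = contradiction (samePair-class sp) (joined-class i≢j sp′)
    ... | yes sp | no _    | no cj≢ci  = contradiction (samePair-class sp) cj≢ci
    ... | no _   | yes sp′ | yes cj≡ci = contradiction cj≡ci (joined-class i≢j sp′)
    ... | yes sp | no ¬sp′ | yes _
      rewrite pairIndicator-yes a b i≢j sp | pairIndicator-no u v ¬sp′
      = 𝟙-no (i H.~? j) λ i~j → [ (λ (_ , ¬sp) → ¬sp sp) , ¬sp′ ]′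
          (proj₂ (Equivalence.to (surgery i j) i~j))
    ... | no ¬sp | yes sp′ | no _
      rewrite pairIndicator-no a b ¬sp | pairIndicator-yes u v i≢j sp′
      = 𝟙-yes (i H.~? j) (Equivalence.from (surgery i j) (i≢j , inj₂ sp′))
    ... | no ¬sp | no ¬sp′ | yes cj≡ci
      rewrite pairIndicator-no a b ¬sp | pairIndicator-no u v ¬sp′
      = 𝟙-yes (i H.~? j) (Equivalence.from (surgery i j) (i≢j , inj₁ (sym cj≡ci , ¬sp)))
    ... | no ¬sp | no ¬sp′ | no cj≢ci
      rewrite pairIndicator-no a b ¬sp | pairIndicator-no u v ¬sp′
      = 𝟙-no (i H.~? j) λ i~j → [ (λ (ci≡cj , _) → cj≢ci (sym ci≡cj)) , ¬sp′ ]′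
          (proj₂ (Equivalence.to (surgery i j) i~j))

    -- On the diagonal `entry` would fail, since i shares its own class without being its own
    -- neighbour; there the factor x i - x i is zero.
    entry-difference : ∀ (x : Fin n → ℚ) i j →
      𝟙 (does (i H.~? j)) * (x i - x j) ≡
      (δ (c j) (c i) * (x i - x j) - pairIndicator a b i j * (x i - x j))
        + pairIndicator u v i j * (x i - x j)
    entry-difference x i j with i ≟ j
    ... | yes refl rewrite ℚ.+-inverseʳ (x i) = solve 4 (λ e f g h →
            e :* con 0ℚ := (f :* con 0ℚ :- g :* con 0ℚ) :+ h :* con 0ℚ) refl
            (𝟙 (does (i H.~? i))) (δ (c i) (c i)) (pairIndicator a b i i) (pairIndicator u v i i)
    ... | no i≢j rewrite entry i≢j = solve 4 (λ e f g d →
            (e :- f :+ g) :* d := (e :* d :- f :* d) :+ g :* d) refl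
            (δ (c j) (c i)) (pairIndicator a b i j) (pairIndicator u v i j) (x i - x j)

  seq-laplacian-surgery : ∀ (w : Fin n → ℝ) i k →
    seq ((laplacian H *ᵥ w) i) k ≡ surgeryOp c a b u v (λ j → seq (w j) k) i
  seq-laplacian-surgery w i k = begin
    seq ((laplacian H *ᵥ w) i) k
      ≡⟨ seq-laplacian H w i k ⟩
    sum (λ j → 𝟙 (does (i H.~? j)) * (x i - x j))
      ≡⟨ sum-cong-≗ (entry-difference x i) ⟩
    sum (λ j → (K j - R j) + J j)
      ≡⟨ ∑-distrib-+ (λ j → K j - R j) J ⟩
    sum (λ j → K j - R j) + sum J
      ≡⟨ cong (_+ sum J) (sum-minus K R) ⟩
    sum K - sum R + sum J
      ≡⟨ cong₂ (λ r s → sum K - r + s) (sum-pairIndicator a b x i) (sum-pairIndicator u v x i) ⟩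
    surgeryOp c a b u v x i ∎
    where
    open ≡-Reasoning
    x K R J : Fin n → ℚ
    x j = seq (w j) k
    K j = δ (c j) (c i) * (x i - x j)
    R j = pairIndicator a b i j * (x i - x j)
    J j = pairIndicator u v i j * (x i - x j)

-- The upper bound on the spectrum of a union of cliques

p≤∣p∣ : ∀ p → p ≤ ℚ.∣ p ∣
p≤∣p∣ p with ℚ.≤-total 0ℚ p
... | inj₁ 0≤p = ℚ.≤-reflexive (sym (ℚ.0≤p⇒∣p∣≡p 0≤p))
... | inj₂ p≤0 = ℚ.≤-trans p≤0 (ℚ.0≤∣p∣ p)

0≤ℕ/1 : ∀ k → 0ℚ ≤ + k / 1
0≤ℕ/1 k = ℚ.nonNegative⁻¹ (+ k / 1) {{ℚ.normalize-nonNeg k 1}}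

/1-mono-≤ : ∀ {k l} → k ℕ.≤ l → + k / 1 ≤ + l / 1
/1-mono-≤ {k} {l} k≤l = begin
  + k / 1                      ≡⟨ ℚ.+-identityʳ (+ k / 1) ⟨
  + k / 1 + 0ℚ                 ≤⟨ ℚ.+-monoʳ-≤ (+ k / 1) (0≤ℕ/1 (l ℕ.∸ k)) ⟩
  + k / 1 + + (l ℕ.∸ k) / 1    ≡⟨ /1-homo-+ (+ k) (+ (l ℕ.∸ k)) ⟨
  + (k ℕ.+ (l ℕ.∸ k)) / 1      ≡⟨ cong (λ m → + m / 1) (ℕ.m+[n∸m]≡n k≤l) ⟩
  + l / 1                      ∎
  where open ℚ.≤-Reasoning

-- `x ≃ y` unfolds to `Null` of the difference of the two sequences, so eigenvalue equations are
-- proved and used in this form.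
Null : (ℕ → ℚ) → Set
Null f = ∀ ε → 0ℚ < ε → ∃ λ N → ∀ n → N ℕ.≤ n → ℚ.∣ f n ∣ < ε

Null-cong : ∀ {f g} → (∀ n → f n ≡ g n) → Null f → Null g
Null-cong f≗g f→0 ε 0<ε with N , h ← f→0 ε 0<ε
  = N , λ n N≤n → subst (λ q → ℚ.∣ q ∣ < ε) (f≗g n) (h n N≤n)

Null-0 : Null (λ _ → 0ℚ)
Null-0 ε 0<ε = 0 , λ _ _ → 0<ε

Null-+ : ∀ {f g} → Null f → Null g → Null (λ n → f n + g n)
Null-+ {f} {g} f→0 g→0 ε 0<ε
  with M , hf ← f→0 (½ * ε) (half-pos 0<ε)
     | N , hg ← g→0 (½ * ε) (half-pos 0<ε)
  = M ℕ.⊔ N , λ n M⊔N≤n → begin-strict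
      ℚ.∣ f n + g n ∣          ≤⟨ ℚ.∣p+q∣≤∣p∣+∣q∣ (f n) (g n) ⟩
      ℚ.∣ f n ∣ + ℚ.∣ g n ∣    <⟨ ℚ.+-mono-< (hf n (ℕ.m⊔n≤o⇒m≤o M N M⊔N≤n))
                                             (hg n (ℕ.m⊔n≤o⇒n≤o M N M⊔N≤n)) ⟩
      ½ * ε + ½ * ε            ≡⟨ halves ε ⟩
      ε                        ∎
  where open ℚ.≤-Reasoning

Null-neg : ∀ {f} → Null f → Null (λ n → - f n)
Null-neg {f} f→0 ε 0<ε with N , h ← f→0 ε 0<ε
  = N , λ n N≤n → subst (_< ε) (sym (ℚ.∣-p∣≡∣p∣ (f n))) (h n N≤n)

Null-minus : ∀ {f g} → Null f → Null g → Null (λ n → f n - g n)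
Null-minus f→0 g→0 = Null-+ f→0 (Null-neg g→0)

Null-sum : ∀ {n} (f : Fin n → ℕ → ℚ) → (∀ j → Null (f j)) → Null (λ k → sum (λ j → f j k))
Null-sum {ℕ.zero}  f f→0 = Null-0
Null-sum {ℕ.suc n} f f→0 = Null-+ (f→0 zero) (Null-sum (f ∘ suc) (f→0 ∘ suc))

-- Stands in for division by a factor bounded away from 0: only the rational bound η is used, and no
-- inverse of a real is formed.
Null-divide : ∀ {f g η N₀} → 0ℚ < η → (∀ n → N₀ ℕ.≤ n → η * ℚ.∣ f n ∣ ≤ ℚ.∣ g n ∣) →
  Null g → Null f
Null-divide {f} {g} {η} {N₀} 0<η bound g→0 ε 0<ε
  with N , h ← g→0 (η * ε) (subst (_< η * ε) (ℚ.*-zeroʳ η) (ℚ.*-monoʳ-<-pos η {{ℚ.positive 0<η}} 0<ε))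
  = N₀ ℕ.⊔ N , λ n N₀⊔N≤n →
      ℚ.*-cancelˡ-<-nonNeg η {{ℚ.nonNegative (ℚ.<⇒≤ 0<η)}}
        (ℚ.≤-<-trans (bound n (ℕ.m⊔n≤o⇒m≤o N₀ N N₀⊔N≤n)) (h n (ℕ.m⊔n≤o⇒n≤o N₀ N N₀⊔N≤n)))

η*∣x∣≤∣t*x∣ : ∀ {η t} x → 0ℚ < η → η ≤ t → η * ℚ.∣ x ∣ ≤ ℚ.∣ t * x ∣
η*∣x∣≤∣t*x∣ {η} {t} x 0<η η≤t = begin
  η * ℚ.∣ x ∣        ≤⟨ ℚ.*-monoʳ-≤-nonNeg ℚ.∣ x ∣ {{ℚ.∣-∣-nonNeg x}} (ℚ.≤-trans η≤t (p≤∣p∣ t)) ⟩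
  ℚ.∣ t ∣ * ℚ.∣ x ∣  ≡⟨ ℚ.∣p*q∣≡∣p∣*∣q∣ t x ⟨
  ℚ.∣ t * x ∣        ∎
  where open ℚ.≤-Reasoning

≤ᵣ-trans : ∀ {x y z} → x ≤ᵣ y → y ≤ᵣ z → x ≤ᵣ z
≤ᵣ-trans {x} {y} {z} x≤y y≤z ε 0<ε
  with M , h ← x≤y (½ * ε) (half-pos 0<ε)
     | N , h′ ← y≤z (½ * ε) (half-pos 0<ε)
  = M ℕ.⊔ N , λ n M⊔N≤n → begin-strict
      seq x n - seq z n
        ≡⟨ solve 3 (λ x y z → x :- z := (x :- y) :+ (y :- z)) refl (seq x n) (seq y n) (seq z n) ⟩
      (seq x n - seq y n) + (seq y n - seq z n)
        <⟨ ℚ.+-mono-< (h n (ℕ.m⊔n≤o⇒m≤o M N M⊔N≤n)) (h′ n (ℕ.m⊔n≤o⇒n≤o M N M⊔N≤n)) ⟩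
      ½ * ε + ½ * ε
        ≡⟨ halves ε ⟩
      ε ∎
  where open ℚ.≤-Reasoning

-- The strict inequality q < x together with its evidence; the gap η is what `Null-divide` later
-- divides by.
EventuallyAbove : ℝ → ℚ → Set
EventuallyAbove x q = ∃ λ η → 0ℚ < η × ∃ λ N → ∀ n → N ℕ.≤ n → q + η ≤ seq x n

-- A Cauchy sequence that is not bounded away above q can be compared with q at a single late index.
¬above⇒≤ : ∀ x q → ¬ EventuallyAbove x q → x ≤ᵣ fromℚ q
¬above⇒≤ x q ¬above ε 0<ε
  -- Tolerance ε/4 and threshold ε/2 fit together: from N on, either x stays below q + ε or it stays
  -- at or above q + ε/4.
  with N , h ← cauchy x (½ * (½ * ε)) (half-pos (half-pos 0<ε))
  with (seq x N - q) ℚ.<? (½ * ε)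
... | yes near = N , λ n N≤n → begin-strict
      seq x n - q
        ≡⟨ solve 3 (λ x y z → x :- z := (x :- y) :+ (y :- z)) refl (seq x n) (seq x N) q ⟩
      (seq x n - seq x N) + (seq x N - q)
        ≤⟨ ℚ.+-monoˡ-≤ (seq x N - q) (p≤∣p∣ (seq x n - seq x N)) ⟩
      ℚ.∣ seq x n - seq x N ∣ + (seq x N - q)
        <⟨ ℚ.+-mono-< (h n N N≤n ℕ.≤-refl) near ⟩
      ½ * (½ * ε) + ½ * ε
        ≤⟨ ℚ.+-monoˡ-≤ (½ * ε) quarter≤half ⟩
      ½ * ε + ½ * ε
        ≡⟨ halves ε ⟩
      ε ∎
  where
  open ℚ.≤-Reasoning
  quarter≤half : ½ * (½ * ε) ≤ ½ * ε
  quarter≤half = begin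
    ½ * (½ * ε)               ≡⟨ ℚ.+-identityʳ _ ⟨
    ½ * (½ * ε) + 0ℚ          ≤⟨ ℚ.+-monoʳ-≤ (½ * (½ * ε)) (ℚ.<⇒≤ (half-pos (half-pos 0<ε))) ⟩
    ½ * (½ * ε) + ½ * (½ * ε) ≡⟨ halves (½ * ε) ⟩
    ½ * ε                     ∎
... | no far = contradiction (η , half-pos (half-pos 0<ε) , N , above) ¬above
  where
  open ℚ.≤-Reasoning
  η = ½ * (½ * ε)
  above : ∀ n → N ℕ.≤ n → q + η ≤ seq x n
  above n N≤n = begin
    q + η
      ≡⟨ solve 2 (λ q η → q :+ η := q :+ (η :+ η) :- η) refl q η ⟩
    q + (η + η) - η
      ≡⟨ cong (λ h → q + h - η) (halves (½ * ε)) ⟩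
    q + ½ * ε - η
      ≤⟨ ℚ.+-monoˡ-≤ (- η) (ℚ.+-monoʳ-≤ q (ℚ.≮⇒≥ far)) ⟩
    q + (seq x N - q) - η
      ≤⟨ ℚ.+-monoʳ-≤ (q + (seq x N - q)) (ℚ.neg-antimono-≤ (ℚ.<⇒≤ (h N n ℕ.≤-refl N≤n))) ⟩
    q + (seq x N - q) - ℚ.∣ seq x N - seq x n ∣
      ≤⟨ ℚ.+-monoʳ-≤ (q + (seq x N - q)) (ℚ.neg-antimono-≤ (p≤∣p∣ (seq x N - seq x n))) ⟩
    q + (seq x N - q) - (seq x N - seq x n)
      ≡⟨ solve 3 (λ q y x → q :+ (y :- q) :- (y :- x) := x) refl q (seq x N) (seq x n) ⟩
    seq x n ∎

cliqueTerm : ∀ {n p} (c : Fin n → Fin p) (x : Fin n → ℚ) → Fin n → ℚ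
cliqueTerm c x i = sum (λ j → δ (c j) (c i) * (x i - x j))

edgeTerm-≡0 : ∀ {n} (a b : Fin n) (x : Fin n → ℚ) i → x a ≡ x b → edgeTerm a b x i ≡ 0ℚ
edgeTerm-≡0 a b x i xa≡xb rewrite xa≡xb | ℚ.+-inverseʳ (x b) = ℚ.*-zeroˡ (δ a i - δ b i)

surgeryOp-cliqueTerm : ∀ {n p} (c : Fin n → Fin p) a b u v (x : Fin n → ℚ) i →
  x a ≡ x b → x u ≡ x v → surgeryOp c a b u v x i ≡ cliqueTerm c x i
surgeryOp-cliqueTerm c a b u v x i xa≡xb xu≡xv
  rewrite edgeTerm-≡0 a b x i xa≡xb | edgeTerm-≡0 u v x i xu≡xv
  = solve 1 (λ k → k :- con 0ℚ :+ con 0ℚ := k) refl (cliqueTerm c x i)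

sum-class : ∀ {n p} (c : Fin n → Fin p) i →
  sum (λ k → δ (c k) (c i)) ≡ + componentSize c (c i) / 1
sum-class c i = sum-𝟙 (λ k → does (c k ≟ c i))

-- On a clique of size s the Laplacian is s I - J with J the all-ones matrix, and J x agrees at any
-- two vertices of the clique.
cliqueTerm-difference : ∀ {n p} (c : Fin n → Fin p) (x : Fin n → ℚ) {i j} → c i ≡ c j →
  cliqueTerm c x i - cliqueTerm c x j ≡ (+ componentSize c (c i) / 1) * (x i - x j)
cliqueTerm-difference c x {i} {j} ci≡cj = begin
  cliqueTerm c x i - cliqueTerm c x j
    ≡⟨ cong (λ r → cliqueTerm c x i - sum (λ k → δ (c k) r * (x j - x k))) ci≡cj ⟨
  cliqueTerm c x i - sum (λ k → δ (c k) (c i) * (x j - x k))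
    ≡⟨ sum-minus (λ k → δ (c k) (c i) * (x i - x k)) (λ k → δ (c k) (c i) * (x j - x k)) ⟨
  sum (λ k → δ (c k) (c i) * (x i - x k) - δ (c k) (c i) * (x j - x k))
    ≡⟨ sum-cong-≗ (λ k → solve 4 (λ e y z w → e :* (y :- w) :- e :* (z :- w) := e :* (y :- z)) refl
         (δ (c k) (c i)) (x i) (x j) (x k)) ⟩
  sum (λ k → δ (c k) (c i) * (x i - x j))
    ≡⟨ *-distribʳ-sum (x i - x j) (λ k → δ (c k) (c i)) ⟨
  sum (λ k → δ (c k) (c i)) * (x i - x j)
    ≡⟨ cong (_* (x i - x j)) (sum-class c i) ⟩
  (+ componentSize c (c i) / 1) * (x i - x j) ∎
  where open ≡-Reasoning

module _ {n p} (G : Graph n) {c : Fin n → Fin p} (disjoint : IsDisjointUnionOfCompletes G c) where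
  private module G = Graph G

  -- Removing and adding nothing makes G itself an instance, so the computation for modified graphs
  -- serves the unmodified one too.
  trivialSurgery : ∀ i → IsSurgery c i i i i G
  trivialSurgery i x y = mk⇔
    (λ x~y → let x≢y , cx≡cy = Equivalence.to (proj₂ disjoint x y) x~y in
       x≢y , inj₁ (cx≡cy , x≢y ∘ same))
    λ { (x≢y , inj₁ (cx≡cy , _)) → Equivalence.from (proj₂ disjoint x y) (x≢y , cx≡cy)
      ; (x≢y , inj₂ sp)          → contradiction (same sp) x≢y }
    where
    same : SamePair i i x y → x ≡ y
    same (inj₁ (x≡i , y≡i)) = trans x≡i (sym y≡i)
    same (inj₂ (x≡i , y≡i)) = trans x≡i (sym y≡i)

  seq-laplacian-clique : ∀ (w : Fin n → ℝ) i k →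
    seq ((laplacian G *ᵥ w) i) k ≡ cliqueTerm c (λ j → seq (w j) k) i
  seq-laplacian-clique w i k = trans
    (seq-laplacian-surgery {H = G} refl (inj₁ refl) (trivialSurgery i) w i k)
    (surgeryOp-cliqueTerm c i i i i (λ j → seq (w j) k) i refl refl)

  -- If ν exceeds every component size s by η, then (ν - s) (vᵢ - vⱼ) vanishes for i, j in one
  -- component, hence so does vᵢ - vⱼ, hence so do (L v)ᵢ and ν vᵢ.
  eigenvalue-≤ : ∀ m → (∀ i → componentSize c i ℕ.≤ m) → ∀ ν → IsEigenvalue (laplacian G) ν → ν ≤ᵣ fromℤ (+ m)
  eigenvalue-≤ m size≤m ν (w , w≄0 , eigen) = ¬above⇒≤ ν (+ m / 1) λ (η , 0<η , N , above) →
    w≄0 λ i → Null-cong (λ k → sym (ℚ.+-identityʳ (x k i))) (Null-coordinate 0<η above i)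
    where
    x : ℕ → Fin n → ℚ
    x k j = seq (w j) k

    residual : Fin n → ℕ → ℚ
    residual i k = cliqueTerm c (x k) i - seq ν k * x k i

    Null-residual : ∀ i → Null (residual i)
    Null-residual i = Null-cong (λ k → cong (_- seq ν k * x k i) (seq-laplacian-clique w i k)) (eigen i)

    module _ {η N} (0<η : 0ℚ < η) (above : ∀ k → N ℕ.≤ k → + m / 1 + η ≤ seq ν k) where
      open ℚ.≤-Reasoning

      η≤ν-s : ∀ s → s ≤ + m / 1 → ∀ k → N ℕ.≤ k → η ≤ seq ν k - s
      η≤ν-s s s≤m k N≤k = begin
        η                   ≡⟨ solve 2 (λ s η → η := (s :+ η) :- s) refl s η ⟩
        (s + η) - s         ≤⟨ ℚ.+-monoˡ-≤ (- s) (ℚ.≤-trans (ℚ.+-monoˡ-≤ η s≤m) (above k N≤k)) ⟩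
        seq ν k - s         ∎

      Null-difference : ∀ {i j} → c j ≡ c i → Null (λ k → x k i - x k j)
      Null-difference {i} {j} cj≡ci = Null-divide {N₀ = N} 0<η
        (λ k N≤k → subst (λ r → η * ℚ.∣ x k i - x k j ∣ ≤ ℚ.∣ r ∣) (sym (difference k))
          (η*∣x∣≤∣t*x∣ (x k i - x k j) 0<η (η≤ν-s s (/1-mono-≤ (size≤m (c i))) k N≤k)))
        (Null-minus (Null-residual j) (Null-residual i))
        where
        s = + componentSize c (c i) / 1
        difference : ∀ k → residual j k - residual i k ≡ (seq ν k - s) * (x k i - x k j)
        difference k = trans
          (solve 5 (λ ki kj ν xi xj → (kj :- ν :* xj) :- (ki :- ν :* xi) := ν :* (xi :- xj) :- (ki :- kj)) refl
            (cliqueTerm c (x k) i) (cliqueTerm c (x k) j) (seq ν k) (x k i) (x k j))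
          (trans (cong (_-_ (seq ν k * (x k i - x k j))) (cliqueTerm-difference c (x k) (sym cj≡ci)))
            (solve 3 (λ ν s d → ν :* d :- s :* d := (ν :- s) :* d) refl (seq ν k) s (x k i - x k j)))

      Null-cliqueTerm : ∀ i → Null (λ k → cliqueTerm c (x k) i)
      Null-cliqueTerm i = Null-sum (λ j k → δ (c j) (c i) * (x k i - x k j)) Null-term
        where
        Null-term : ∀ j → Null (λ k → δ (c j) (c i) * (x k i - x k j))
        Null-term j with c j ≟ c i
        ... | yes cj≡ci = Null-cong (λ k → sym (ℚ.*-identityˡ (x k i - x k j))) (Null-difference cj≡ci)
        ... | no  _     = Null-cong (λ k → sym (ℚ.*-zeroˡ (x k i - x k j))) Null-0

      Null-coordinate : ∀ i → Null (λ k → x k i)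
      Null-coordinate i = Null-divide {N₀ = N} 0<η
        -- The gap is used with s = 0: since 0 ≤ m, ν itself is eventually at least η.
        (λ k N≤k → subst (λ r → η * ℚ.∣ x k i ∣ ≤ ℚ.∣ r ∣)
          (solve 3 (λ ν y l → (ν :- con 0ℚ) :* y := l :- (l :- ν :* y)) refl (seq ν k) (x k i) (cliqueTerm c (x k) i))
          (η*∣x∣≤∣t*x∣ (x k i) 0<η (η≤ν-s 0ℚ (0≤ℕ/1 m) k N≤k)))
        (Null-minus (Null-cliqueTerm i) (Null-residual i))

-- Counting in cliques

∣p∣≤1+∣p-x∣ : ∀ {n} (p : Subset n) x → ∣ p ∣ ℕ.≤ ℕ.suc ∣ p Subset.- x ∣
∣p∣≤1+∣p-x∣ (inside  ∷ p) zero    = ℕ.s≤s (ℕ.≤-reflexive (cong ∣_∣ (sym (Subset.p─⊥≡p p))))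
∣p∣≤1+∣p-x∣ (outside ∷ p) zero    = ℕ.m≤n⇒m≤1+n (ℕ.≤-reflexive (cong ∣_∣ (sym (Subset.p─⊥≡p p))))
∣p∣≤1+∣p-x∣ (inside  ∷ p) (suc x) = ℕ.s≤s (∣p∣≤1+∣p-x∣ p x)
∣p∣≤1+∣p-x∣ (outside ∷ p) (suc x) = ∣p∣≤1+∣p-x∣ p x

x∉p-x : ∀ {n} (p : Subset n) x → x ∉ p Subset.- x
x∉p-x (inside  ∷ p) (suc x) (there x∈) = x∉p-x p x x∈
x∉p-x (outside ∷ p) (suc x) (there x∈) = x∉p-x p x x∈

-- Deleting a listed element costs at most one, even if it is repeated or lies outside p, so
-- something survives.
pick : ∀ {n k} (p : Subset n) (xs : Vec (Fin n) k) → k ℕ.< ∣ p ∣ →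
  ∃ λ z → z ∈ p × All (z ≢_) xs
pick {n} p [] 0<∣p∣ with Subset.nonempty? p
... | yes (z , z∈p) = z , z∈p , []
... | no  empty     = contradiction 0<∣p∣
  (ℕ.<-irrefl (sym (trans (cong ∣_∣ (Subset.Empty-unique empty)) (Subset.∣⊥∣≡0 n))))
pick p (x ∷ xs) k<∣p∣ with z , z∈p-x , z≢xs ← pick (p Subset.- x) xs (ℕ.≤-pred (ℕ.≤-trans k<∣p∣ (∣p∣≤1+∣p-x∣ p x)))
  = z , Subset.p─q⊆p p Subset.⁅ x ⁆ z∈p-x , (λ { refl → x∉p-x p x z∈p-x }) ∷ z≢xs

All-∈-remove : ∀ {n k} {p : Subset n} {x} {xs : Vec (Fin n) k} →
  All (x ≢_) xs → All (_∈ p) xs → All (_∈ p Subset.- x) xs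
All-∈-remove []            []           = []
All-∈-remove (x≢z ∷ x≢xs) (z∈p ∷ xs⊆p) =
  Subset.x∈p∧x≢y⇒x∈p-y z∈p (≢-sym x≢z) ∷ All-∈-remove x≢xs xs⊆p

-- Pigeonhole: deleting a listed element lowers both bounds by one, and a set of size 0 has no
-- member y left to miss.
exhaust : ∀ {n k} (p : Subset n) {xs : Vec (Fin n) k} → Unique xs → All (_∈ p) xs →
  ∣ p ∣ ℕ.≤ k → ∀ y → y ∈ p → ∃ λ t → lookup xs t ≡ y
exhaust p [] [] ∣p∣≤0 y y∈p = contradiction (ℕ.≤-trans (Subset.x∈p⇒∣p-x∣<∣p∣ y∈p) ∣p∣≤0) λ ()
exhaust p {x ∷ xs} (x≢xs ∷ unique) (x∈p ∷ xs⊆p) ∣p∣≤k y y∈p with y ≟ x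
... | yes refl = zero , refl
... | no  y≢x
  with t , eq ← exhaust (p Subset.- x) unique (All-∈-remove x≢xs xs⊆p)
         (ℕ.≤-pred (ℕ.≤-trans (Subset.x∈p⇒∣p-x∣<∣p∣ x∈p) ∣p∣≤k))
         y (Subset.x∈p∧x≢y⇒x∈p-y y∈p y≢x)
  = suc t , eq

length≤∣p∣ : ∀ {n k} (p : Subset n) {xs : Vec (Fin n) k} → Unique xs → All (_∈ p) xs → k ℕ.≤ ∣ p ∣
length≤∣p∣ p [] [] = ℕ.z≤n
length≤∣p∣ p (x≢xs ∷ unique) (x∈p ∷ xs⊆p) = ℕ.≤-trans
  (ℕ.s≤s (length≤∣p∣ (p Subset.- _) unique (All-∈-remove x≢xs xs⊆p)))
  (Subset.x∈p⇒∣p-x∣<∣p∣ x∈p)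

-- A clique with its vertices in a chosen order, so that a small model can be matched with it
-- position by position.
record Enumerates {n p k} (c : Fin n → Fin p) (D : Fin p) (xs : Vec (Fin n) k) : Set where
  constructor enumerates
  field
    unique   : Unique xs
    within   : All (λ x → c x ≡ D) xs
    complete : ∀ y → c y ≡ D → ∃ λ t → lookup xs t ≡ y

module _ {n p} (c : Fin n → Fin p) where

  fibre : Fin p → Subset n
  fibre D = tabulate (λ v → does (c v ≟ D))

  ∈-fibre⁺ : ∀ {D v} → c v ≡ D → v ∈ fibre D
  ∈-fibre⁺ {D} {v} cv≡D = Vec.lookup⇒[]= v (fibre D)
    (trans (Vec.lookup∘tabulate (λ v → does (c v ≟ D)) v) (dec-true (c v ≟ D) cv≡D))

  ∈-fibre⁻ : ∀ {D v} → v ∈ fibre D → c v ≡ D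
  ∈-fibre⁻ {D} {v} v∈ with c v ≟ D | trans (sym (Vec.lookup∘tabulate (λ v → does (c v ≟ D)) v)) (Vec.[]=⇒lookup v∈)
  ... | yes cv≡D | _ = cv≡D

  another : ∀ {k} D (xs : Vec (Fin n) k) → k ℕ.< componentSize c D →
    ∃ λ z → c z ≡ D × All (z ≢_) xs
  another D xs k< with z , z∈ , z≢xs ← pick (fibre D) xs k< = z , ∈-fibre⁻ z∈ , z≢xs

  enumerate : ∀ {k} D {xs : Vec (Fin n) k} → Unique xs → All (λ x → c x ≡ D) xs →
    componentSize c D ℕ.≤ k → Enumerates c D xs
  enumerate D unique within size≤k = enumerates unique within
    λ y cy≡D → exhaust (fibre D) unique (All.map ∈-fibre⁺ within) size≤k y (∈-fibre⁺ cy≡D)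

  length≤componentSize : ∀ {k} D {xs : Vec (Fin n) k} → Unique xs → All (λ x → c x ≡ D) xs →
    k ℕ.≤ componentSize c D
  length≤componentSize D unique within = length≤∣p∣ (fibre D) unique (All.map ∈-fibre⁺ within)

≤-maximum : ∀ {p} (s : Fin p → ℕ) i → s i ℕ.≤ maximum s
≤-maximum s zero    = ℕ.m≤m⊔n (s zero) _
≤-maximum s (suc i) = ℕ.≤-trans (≤-maximum (s ∘ suc) i) (ℕ.m≤n⊔m (s zero) _)

maximum-attained : ∀ p (s : Fin (ℕ.suc p) → ℕ) → ∃ λ i → s i ≡ maximum s
maximum-attained ℕ.zero    s = zero , sym (ℕ.⊔-identityʳ (s zero))
maximum-attained (ℕ.suc p) s with maximum-attained p (s ∘ suc) | ℕ.⊔-sel (s zero) (maximum (s ∘ suc))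
... | _            | inj₁ eq = zero , sym eq
... | i , si≡max   | inj₂ eq = suc i , trans si≡max (sym eq)

-- Eigenpairs of a modified union of cliques

-- Speaks of the operator and not of a graph, so a small model needs no adjacency relation and can
-- be transported along an embedding. `nonzero` names a coordinate because that coordinate is what
-- the embedding carries over.
record LargeEigenpair {n p} (c : Fin n → Fin p) (a b u v : Fin n) (m : ℕ) : Set where
  constructor largeEigenpair
  field
    value   : ℝ
    vector  : Fin n → ℝ
    nonzero : ∃ λ i → ¬ vector i ≃ 0ℝ
    eigen   : ∀ i → Null (λ k →
      surgeryOp c a b u v (λ j → seq (vector j) k) i - seq value k * seq (vector i) k)
    large   : fromℤ (+ m) ≤ᵣ value

edgeTerm-swap : ∀ {n} (a b : Fin n) x i → edgeTerm a b x i ≡ edgeTerm b a x i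
edgeTerm-swap a b x i = solve 4 (λ xa xb e f → (xa :- xb) :* (e :- f) := (xb :- xa) :* (f :- e)) refl
  (x a) (x b) (δ a i) (δ b i)

module _ {n p} {c : Fin n → Fin p} {a b u v : Fin n} {m : ℕ} where

  swap-removed : LargeEigenpair c a b u v m → LargeEigenpair c b a u v m
  swap-removed (largeEigenpair μ w w≄0 eigen m≤μ) = largeEigenpair μ w w≄0
    (λ i → Null-cong (λ k → cong (λ e → cliqueTerm c (λ j → seq (w j) k) i - e
        + edgeTerm u v (λ j → seq (w j) k) i - seq μ k * seq (w i) k)
      (edgeTerm-swap a b (λ j → seq (w j) k) i)) (eigen i)) m≤μ

  swap-added : LargeEigenpair c a b u v m → LargeEigenpair c a b v u m
  swap-added (largeEigenpair μ w w≄0 eigen m≤μ) = largeEigenpair μ w w≄0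
    (λ i → Null-cong (λ k → cong (λ e → cliqueTerm c (λ j → seq (w j) k) i
        - edgeTerm a b (λ j → seq (w j) k) i + e - seq μ k * seq (w i) k)
      (edgeTerm-swap u v (λ j → seq (w j) k) i)) (eigen i)) m≤μ

  exactEigenpair : ∀ (y : Fin n → ℚ) r → (∀ i → surgeryOp c a b u v y i ≡ r * y i) →
    ∀ i → y i ≢ 0ℚ → + m / 1 ≤ r → LargeEigenpair c a b u v m
  exactEigenpair y r eigen i yi≢0 m≤r = largeEigenpair (fromℚ r) (fromℚ ∘ y) (i , yi≄0)
    (λ j → Null-cong (λ _ → sym (trans (cong (_- r * y j) (eigen j)) (ℚ.+-inverseʳ (r * y j)))) Null-0)
    λ ε 0<ε → 0 , λ _ _ → ℚ.≤-<-trans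
      (ℚ.≤-trans (ℚ.+-monoˡ-≤ (- r) m≤r) (ℚ.≤-reflexive (ℚ.+-inverseʳ r))) 0<ε
    where
    yi≄0 : ¬ fromℚ (y i) ≃ 0ℝ
    yi≄0 yi≃0 with N , h ← yi≃0 ℚ.∣ y i ∣
      (ℚ.≰⇒> λ ∣yi∣≤0 → yi≢0 (ℚ.∣p∣≡0⇒p≡0 (y i) (ℚ.≤-antisym ∣yi∣≤0 (ℚ.0≤∣p∣ (y i)))))
      = ℚ.<-irrefl (cong ℚ.∣_∣ (ℚ.+-identityʳ (y i))) (h N ℕ.≤-refl)

CliqueEigenvector : ∀ {n p} (c : Fin n → Fin p) → ℕ → (Fin n → ℚ) → Set
CliqueEigenvector c m y = ∀ i → cliqueTerm c y i ≡ (+ m / 1) * y i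

twins : ∀ {n} (x z : Fin n) → Fin n → ℚ
twins x z i = δ x i - δ z i

module _ {n p} (c : Fin n → Fin p) (m : ℕ) where

  CliqueEigenvector-+ : ∀ y z → CliqueEigenvector c m y → CliqueEigenvector c m z →
    CliqueEigenvector c m (λ i → y i + z i)
  CliqueEigenvector-+ y z ey ez i = begin
    sum (λ j → e j * ((y i + z i) - (y j + z j)))
      ≡⟨ sum-cong-≗ (λ j → solve 5 (λ e yi zi yj zj → e :* ((yi :+ zi) :- (yj :+ zj)) :=
           e :* (yi :- yj) :+ e :* (zi :- zj)) refl (e j) (y i) (z i) (y j) (z j)) ⟩
    sum (λ j → e j * (y i - y j) + e j * (z i - z j))
      ≡⟨ ∑-distrib-+ (λ j → e j * (y i - y j)) (λ j → e j * (z i - z j)) ⟩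
    cliqueTerm c y i + cliqueTerm c z i
      ≡⟨ cong₂ _+_ (ey i) (ez i) ⟩
    (+ m / 1) * y i + (+ m / 1) * z i
      ≡⟨ ℚ.*-distribˡ-+ (+ m / 1) (y i) (z i) ⟨
    (+ m / 1) * (y i + z i) ∎
    where
    open ≡-Reasoning
    e : Fin n → ℚ
    e j = δ (c j) (c i)

  -- The coordinates sum to zero on the clique, which kills the all-ones part and leaves
  -- multiplication by the size of the clique of i. That size may be replaced by m because the
  -- vector vanishes outside one clique of size m.
  CliqueEigenvector-twins : ∀ x z → c x ≡ c z → componentSize c (c x) ≡ m →
    CliqueEigenvector c m (twins x z)
  CliqueEigenvector-twins x z cx≡cz size≡m i = begin
    sum (λ j → e j * (twins x z i - twins x z j))
      ≡⟨ sum-cong-≗ (λ j → solve 4 (λ e d xj zj → e :* (d :- (xj :- zj)) :=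
           e :* d :- (xj :* e :- zj :* e)) refl (e j) (twins x z i) (δ x j) (δ z j)) ⟩
    sum (λ j → e j * twins x z i - (δ x j * e j - δ z j * e j))
      ≡⟨ sum-minus (λ j → e j * twins x z i) (λ j → δ x j * e j - δ z j * e j) ⟩
    sum (λ j → e j * twins x z i) - sum (λ j → δ x j * e j - δ z j * e j)
      ≡⟨ cong₂ _-_ (sym (*-distribʳ-sum (twins x z i) e)) cancel ⟩
    sum e * twins x z i - 0ℚ
      ≡⟨ solve 1 (λ q → q :- con 0ℚ := q) refl (sum e * twins x z i) ⟩
    sum e * twins x z i
      ≡⟨ cong (_* twins x z i) (sum-class c i) ⟩
    (+ componentSize c (c i) / 1) * twins x z i
      ≡⟨ support ⟩
    (+ m / 1) * twins x z i ∎
    where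
    open ≡-Reasoning
    e : Fin n → ℚ
    e j = δ (c j) (c i)
    cancel : sum (λ j → δ x j * e j - δ z j * e j) ≡ 0ℚ
    cancel = begin
      sum (λ j → δ x j * e j - δ z j * e j)
        ≡⟨ sum-minus (λ j → δ x j * e j) (λ j → δ z j * e j) ⟩
      sum (λ j → δ x j * e j) - sum (λ j → δ z j * e j)
        ≡⟨ cong₂ _-_ (sum-δ x e) (sum-δ z e) ⟩
      δ (c x) (c i) - δ (c z) (c i)
        ≡⟨ cong (λ r → δ (c x) (c i) - δ r (c i)) cx≡cz ⟨
      δ (c x) (c i) - δ (c x) (c i)
        ≡⟨ ℚ.+-inverseʳ (δ (c x) (c i)) ⟩
      0ℚ ∎
    size⊎zero : componentSize c (c i) ≡ m ⊎ twins x z i ≡ 0ℚ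
    size⊎zero with x ≟ i | z ≟ i
    ... | yes refl | _        = inj₁ size≡m
    ... | no _     | yes refl = inj₁ (trans (cong (componentSize c) (sym cx≡cz)) size≡m)
    ... | no _     | no _     = inj₂ refl
    support : (+ componentSize c (c i) / 1) * twins x z i ≡ (+ m / 1) * twins x z i
    support with size⊎zero
    ... | inj₁ size≡m  = cong (λ s → (+ s / 1) * twins x z i) size≡m
    ... | inj₂ zero-at = trans (cong (_*_ (+ componentSize c (c i) / 1)) zero-at)
          (trans (ℚ.*-zeroʳ (+ componentSize c (c i) / 1))
            (sym (trans (cong (_*_ (+ m / 1)) zero-at) (ℚ.*-zeroʳ (+ m / 1)))))

  balancedEigenpair : ∀ {a b u v} y → CliqueEigenvector c m y → y a ≡ y b → y u ≡ y v →
    ∀ i → y i ≢ 0ℚ → LargeEigenpair c a b u v m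
  balancedEigenpair {a} {b} {u} {v} y ey ya≡yb yu≡yv i yi≢0 = exactEigenpair y (+ m / 1)
    (λ j → trans (surgeryOp-cliqueTerm c a b u v y j ya≡yb yu≡yv) (ey j)) i yi≢0 ℚ.≤-refl

-- Extending eigenpairs of small models by zero

δ-comm : ∀ {n} (i j : Fin n) → δ i j ≡ δ j i
δ-comm i j with i ≟ j
... | yes refl = sym (δ-refl i)
... | no  i≢j  = sym (δ-≢ (≢-sym i≢j))

inImage? : ∀ {k n} (w : Fin k → Fin n) j → (∃ λ t → w t ≡ j) ⊎ (∀ t → w t ≢ j)
inImage? w j with any? (λ t → w t ≟ j)
... | yes j∈w = inj₁ j∈w
... | no  j∉w = inj₂ λ t wt≡j → j∉w (t , wt≡j)

module _ {k n} (w : Fin k → Fin n) (w-injective : ∀ {s t} → w s ≡ w t → s ≡ t) where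

  δ-injective : ∀ s t → δ (w s) (w t) ≡ δ s t
  δ-injective s t with s ≟ t
  ... | yes refl = δ-refl (w s)
  ... | no  s≢t  = δ-≢ (s≢t ∘ w-injective)

  -- By injectivity f is a combination of point masses at the w t, one for each t; exchanging the
  -- two sums evaluates each of them.
  sum-image : ∀ (f : Fin n → ℚ) → (∀ j → (∀ t → w t ≢ j) → f j ≡ 0ℚ) → sum f ≡ sum (f ∘ w)
  sum-image f f≡0 = begin
    sum f                                          ≡⟨ sum-cong-≗ spread ⟩
    sum (λ j → sum (λ t → δ (w t) j * f (w t)))    ≡⟨ ∑-comm (λ j t → δ (w t) j * f (w t)) ⟩
    sum (λ t → sum (λ j → δ (w t) j * f (w t)))    ≡⟨ sum-cong-≗ (λ t → sum-δ (w t) (λ _ → f (w t))) ⟩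
    sum (f ∘ w)                                    ∎
    where
    open ≡-Reasoning
    spread : ∀ j → f j ≡ sum (λ t → δ (w t) j * f (w t))
    spread j with inImage? w j
    ... | inj₁ (s , refl) = sym (trans
            (sum-cong-≗ (λ t → cong (_* f (w t)) (trans (δ-injective t s) (δ-comm t s))))
            (sum-δ s (f ∘ w)))
    ... | inj₂ j∉w = trans (f≡0 j j∉w)
            (sym (sum-≡0 _ (λ t → trans (cong (_* f (w t)) (δ-≢ (j∉w t))) (ℚ.*-zeroˡ (f (w t))))))

  module _ {A : Set} (z : A) (y : Fin k → A) where
    -- Used for A = ℝ on the eigenvector and for A = ℚ on its approximations; `seq-extend` says that
    -- the two agree.
    extend : Fin n → A
    extend j with any? (λ t → w t ≟ j)
    ... | yes (t , _) = y t
    ... | no  _       = z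

    extend-image : ∀ t → extend (w t) ≡ y t
    extend-image t with any? (λ s → w s ≟ w t)
    ... | yes (s , ws≡wt) = cong y (w-injective ws≡wt)
    ... | no  t∉w         = contradiction (t , refl) t∉w

    extend-outside : ∀ j → (∀ t → w t ≢ j) → extend j ≡ z
    extend-outside j j∉w with any? (λ t → w t ≟ j)
    ... | yes (t , wt≡j) = contradiction wt≡j (j∉w t)
    ... | no  _          = refl

  seq-extend : ∀ (y : Fin k → ℝ) l j → seq (extend 0ℝ y j) l ≡ extend 0ℚ (λ t → seq (y t) l) j
  seq-extend y l j with any? (λ t → w t ≟ j)
  ... | yes _ = refl
  ... | no  _ = refl

-- How an edge of the model stands for an actual edge. In the last two cases the model edge is
-- degenerate and contributes nothing; the actual edge contributes nothing either, because the
-- extension is 0 at both its ends or because a ≡ b.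
data Represents {k n} (w : Fin k → Fin n) (a b : Fin n) (α β : Fin k) : Set where
  inside  : w α ≡ a → w β ≡ b → Represents w a b α β
  outside : (∀ t → w t ≢ a) → (∀ t → w t ≢ b) → α ≡ β → Represents w a b α β
  equal   : a ≡ b → α ≡ β → Represents w a b α β

-- w identifies the abstract cliques e with a union of cliques of c.
record ClosedEmbedding {k q n p} (e : Fin k → Fin q) (c : Fin n → Fin p) (w : Fin k → Fin n) : Set where
  field
    injective : ∀ {s t} → w s ≡ w t → s ≡ t
    classes   : ∀ s t → c (w s) ≡ c (w t) ⇔ e s ≡ e t
    closed    : ∀ t j → c j ≡ c (w t) → ∃ λ s → w s ≡ j

module _ {k q n p} {e : Fin k → Fin q} {c : Fin n → Fin p} {w : Fin k → Fin n}
         (embedding : ClosedEmbedding e c w) where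
  open ClosedEmbedding embedding

  module _ (y : Fin k → ℚ) where
    private
      x : Fin n → ℚ
      x = extend w injective 0ℚ y

      x-image : ∀ t → x (w t) ≡ y t
      x-image = extend-image w injective 0ℚ y

      x-outside : ∀ j → (∀ t → w t ≢ j) → x j ≡ 0ℚ
      x-outside = extend-outside w injective 0ℚ y

      δ-class : ∀ s t → δ (c (w s)) (c (w t)) ≡ δ (e s) (e t)
      δ-class s t with e s ≟ e t
      ... | yes es≡et = 𝟙-yes (c (w s) ≟ c (w t)) (Equivalence.from (classes s t) es≡et)
      ... | no  es≢et = 𝟙-no (c (w s) ≟ c (w t)) (es≢et ∘ Equivalence.to (classes s t))

    cliqueTerm-image : ∀ t → cliqueTerm c x (w t) ≡ cliqueTerm e y t
    cliqueTerm-image t = trans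
      (sum-image w injective (λ j → δ (c j) (c (w t)) * (x (w t) - x j)) vanish)
      (sum-cong-≗ (λ s → cong₂ _*_ (δ-class s t) (cong₂ _-_ (x-image t) (x-image s))))
      where
      vanish : ∀ j → (∀ s → w s ≢ j) → δ (c j) (c (w t)) * (x (w t) - x j) ≡ 0ℚ
      vanish j j∉w = trans (cong (_* (x (w t) - x j))
          (δ-≢ (λ cj≡cwt → let s , ws≡j = closed t j cj≡cwt in j∉w s ws≡j)))
        (ℚ.*-zeroˡ (x (w t) - x j))

    cliqueTerm-outside : ∀ i → (∀ t → w t ≢ i) → cliqueTerm c x i ≡ 0ℚ
    cliqueTerm-outside i i∉w = sum-≡0 _ vanish
      where
      vanish : ∀ j → δ (c j) (c i) * (x i - x j) ≡ 0ℚ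
      vanish j with inImage? w j
      ... | inj₁ (s , refl) = trans (cong (_* (x i - x (w s)))
            (δ-≢ (λ cws≡ci → let t , wt≡i = closed s i (sym cws≡ci) in i∉w t wt≡i)))
          (ℚ.*-zeroˡ (x i - x (w s)))
      ... | inj₂ j∉w rewrite x-outside i i∉w | x-outside j j∉w = ℚ.*-zeroʳ (δ (c j) (c i))

    edgeTerm-image : ∀ {a b α β} → Represents w a b α β → ∀ t → edgeTerm a b x (w t) ≡ edgeTerm α β y t
    edgeTerm-image {α = α} {β} (inside refl refl) t = cong₂ _*_
      (cong₂ _-_ (x-image α) (x-image β))
      (cong₂ _-_ (δ-injective w injective α t) (δ-injective w injective β t))
    edgeTerm-image {a} {b} {α} (outside a∉w b∉w refl) t = trans
      (edgeTerm-≡0 a b x (w t) (trans (x-outside a a∉w) (sym (x-outside b b∉w))))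
      (sym (edgeTerm-≡0 α α y t refl))
    edgeTerm-image {a} {α = α} (equal refl refl) t = trans
      (edgeTerm-≡0 a a x (w t) refl) (sym (edgeTerm-≡0 α α y t refl))

    edgeTerm-outside : ∀ {a b α β} → Represents w a b α β → ∀ i → (∀ t → w t ≢ i) → edgeTerm a b x i ≡ 0ℚ
    edgeTerm-outside {α = α} {β} (inside refl refl) i i∉w
      rewrite δ-≢ (i∉w α) | δ-≢ (i∉w β) = ℚ.*-zeroʳ (x (w α) - x (w β))
    edgeTerm-outside {a} {b} (outside a∉w b∉w _) i _ =
      edgeTerm-≡0 a b x i (trans (x-outside a a∉w) (sym (x-outside b b∉w)))
    edgeTerm-outside {a} (equal refl _) i _ = edgeTerm-≡0 a a x i refl

  -- Extension by zero commutes with the operator: the image consists of whole cliques, and an edge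
  -- with a non-zero term has both ends in it.
  embedEigenpair : ∀ {a b u v α β γ κ m} → Represents w a b α β → Represents w u v γ κ →
    LargeEigenpair e α β γ κ m → LargeEigenpair c a b u v m
  embedEigenpair {a} {b} {u} {v} {α} {β} {γ} {κ} ab uv (largeEigenpair μ y (t₀ , y≄0) eigen m≤μ) =
    largeEigenpair μ x (w t₀ , subst (λ r → ¬ r ≃ 0ℝ) (sym (extend-image w injective 0ℝ y t₀)) y≄0) eigen′ m≤μ
    where
    x : Fin n → ℝ
    x = extend w injective 0ℝ y

    xᵣ : ℕ → Fin n → ℚ
    xᵣ l = extend w injective 0ℚ (λ t → seq (y t) l)

    surgeryOp-extend : ∀ l i → surgeryOp c a b u v (λ j → seq (x j) l) i ≡ surgeryOp c a b u v (xᵣ l) i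
    surgeryOp-extend l i = cong₂ _+_ (cong₂ _-_
        (sum-cong-≗ (λ j → cong₂ (λ r s → δ (c j) (c i) * (r - s)) (xl i) (xl j)))
        (cong₂ (λ r s → (r - s) * (δ a i - δ b i)) (xl a) (xl b)))
        (cong₂ (λ r s → (r - s) * (δ u i - δ v i)) (xl u) (xl v))
      where
      xl = seq-extend w injective y l

    eigen′ : ∀ i → Null (λ l → surgeryOp c a b u v (λ j → seq (x j) l) i - seq μ l * seq (x i) l)
    eigen′ i with inImage? w i
    ... | inj₁ (t , refl) = Null-cong (λ l → let z = λ s → seq (y s) l in sym (cong₂ _-_
            (trans (surgeryOp-extend l (w t)) (cong₂ _+_ (cong₂ _-_
              (cliqueTerm-image z t) (edgeTerm-image z ab t)) (edgeTerm-image z uv t)))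
            (cong (λ r → seq μ l * seq r l) (extend-image w injective 0ℝ y t))))
          (eigen t)
    ... | inj₂ i∉w = Null-cong (λ l → let z = λ s → seq (y s) l in sym (trans (cong₂ _-_
            (trans (surgeryOp-extend l i) (cong₂ _+_ (cong₂ _-_
              (cliqueTerm-outside z i i∉w) (edgeTerm-outside z ab i i∉w)) (edgeTerm-outside z uv i i∉w)))
            (cong (λ r → seq μ l * seq r l) (extend-outside w injective 0ℝ y i i∉w)))
            (solve 1 (λ r → con 0ℚ :- con 0ℚ :+ con 0ℚ :- r :* con 0ℚ := con 0ℚ) refl (seq μ l))))
          Null-0

-- Roots of cubics by bisection

2ℚ 3ℚ 5ℚ : ℚ
2ℚ = + 2 / 1
3ℚ = + 3 / 1
5ℚ = + 5 / 1

archimedean : ∀ q → ∃ λ N → q < + N / 1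
archimedean q = N , subst (q <_) (sym (ℚ.↥p/↧p≡p Nℚ)) (ℚ.*<* (begin-strict
    ↥ q ℤ.* + 1            ≡⟨ ℤ.*-identityʳ (↥ q) ⟩
    ↥ q                    ≤⟨ i≤∣i∣ (↥ q) ⟩
    + ℤ.∣ ↥ q ∣            <⟨ ℤ.+<+ (ℕ.n<1+n ℤ.∣ ↥ q ∣) ⟩
    + N                    ≤⟨ ℤ.+≤+ (ℕ.m≤m*n N (ℚ.↧ₙ q)) ⟩
    + (N ℕ.* ℚ.↧ₙ q)       ≡⟨ ℤ.pos-* N (ℚ.↧ₙ q) ⟩
    + N ℤ.* ↧ q            ∎))
  where
  open ℤ.≤-Reasoning
  -- A denominator is at least 1, so 1 plus the absolute numerator already exceeds q.
  N = ℕ.suc ℤ.∣ ↥ q ∣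
  Nℚ = mkℚ (+ N) 0 (Coprime.sym (Coprime.1-coprimeTo N))
  i≤∣i∣ : ∀ i → i ℤ.≤ + ℤ.∣ i ∣
  i≤∣i∣ (+ n)        = ℤ.≤-refl
  i≤∣i∣ ℤ.-[1+ n ]   = ℤ.-≤+

-- The length of the bracket after n halvings of [3 , 5].
width : ℕ → ℚ
width ℕ.zero    = 2ℚ
width (ℕ.suc n) = ½ * width n

0≤width : ∀ n → 0ℚ ≤ width n
0≤width ℕ.zero    = from-yes (0ℚ ℚ.≤? 2ℚ)
0≤width (ℕ.suc n) = subst (_≤ ½ * width n) (ℚ.*-zeroʳ ½) (ℚ.*-monoˡ-≤-nonNeg ½ (0≤width n))

width≤2 : ∀ n → width n ≤ 2ℚ
width≤2 ℕ.zero    = ℚ.≤-refl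
width≤2 (ℕ.suc n) = ℚ.≤-trans (ℚ.*-monoˡ-≤-nonNeg ½ (width≤2 n)) (from-yes (½ * 2ℚ ℚ.≤? 2ℚ))

-- A decay of order 1/n is all that convergence needs, and it passes through the halving: the two
-- halves are bounded by width n ≤ 2 and by the induction hypothesis.
n*width≤2 : ∀ n → (+ n / 1) * width n ≤ 2ℚ
n*width≤2 ℕ.zero    = from-yes ((+ 0 / 1) * 2ℚ ℚ.≤? 2ℚ)
n*width≤2 (ℕ.suc n) = begin
  (+ ℕ.suc n / 1) * (½ * width n)
    ≡⟨ cong (_* (½ * width n)) (/1-homo-+ (+ 1) (+ n)) ⟩
  (1ℚ + + n / 1) * (½ * width n)
    ≡⟨ solve 2 (λ k w → (con 1ℚ :+ k) :* (con ½ :* w) := con ½ :* w :+ con ½ :* (k :* w)) refl (+ n / 1) (width n) ⟩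
  ½ * width n + ½ * ((+ n / 1) * width n)
    ≤⟨ ℚ.+-mono-≤ (ℚ.*-monoˡ-≤-nonNeg ½ (width≤2 n)) (ℚ.*-monoˡ-≤-nonNeg ½ (n*width≤2 n)) ⟩
  ½ * 2ℚ + ½ * 2ℚ
    ≡⟨ halves 2ℚ ⟩
  2ℚ ∎
  where open ℚ.≤-Reasoning

abstract
  width→0 : ∀ ε → 0ℚ < ε → ∃ λ N → ∀ n → N ℕ.≤ n → width n < ε
  width→0 ε 0<ε with q , _ , ε*q≡2 ← quotient 0<ε (ℚ.positive⁻¹ 2ℚ) with N , q<N ← archimedean q
    = N , λ n N≤n → ℚ.*-cancelˡ-<-nonNeg (+ n / 1) {{ℚ.nonNegative (0≤ℕ/1 n)}} (begin-strict
        (+ n / 1) * width n    ≤⟨ n*width≤2 n ⟩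
        2ℚ                     ≡⟨ ε*q≡2 ⟨
        ε * q                  <⟨ ℚ.*-monoʳ-<-pos ε {{ℚ.positive 0<ε}} (ℚ.<-≤-trans q<N (/1-mono-≤ N≤n)) ⟩
        ε * (+ n / 1)          ≡⟨ ℚ.*-comm ε (+ n / 1) ⟩
        (+ n / 1) * ε          ∎)
    where open ℚ.≤-Reasoning

∣x-y∣≤w : ∀ {x y a w} → a ≤ x → x ≤ a + w → a ≤ y → y ≤ a + w → ℚ.∣ x - y ∣ ≤ w
∣x-y∣≤w {x} {y} {a} {w} a≤x x≤ a≤y y≤ with ℚ.∣p∣≡p∨∣p∣≡-p (x - y)
... | inj₁ eq = begin
  ℚ.∣ x - y ∣     ≡⟨ eq ⟩
  x - y           ≤⟨ ℚ.+-mono-≤ x≤ (ℚ.neg-antimono-≤ a≤y) ⟩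
  (a + w) - a     ≡⟨ solve 2 (λ a w → (a :+ w) :- a := w) refl a w ⟩
  w               ∎
  where open ℚ.≤-Reasoning
... | inj₂ eq = begin
  ℚ.∣ x - y ∣     ≡⟨ eq ⟩
  - (x - y)       ≡⟨ solve 2 (λ x y → :- (x :- y) := y :- x) refl x y ⟩
  y - x           ≤⟨ ℚ.+-mono-≤ y≤ (ℚ.neg-antimono-≤ a≤x) ⟩
  (a + w) - a     ≡⟨ solve 2 (λ a w → (a :+ w) :- a := w) refl a w ⟩
  w               ∎
  where open ℚ.≤-Reasoning

-- The signs at rational points are decidable, so bisection runs exactly. A one-sided slope bound
-- replaces continuity: across a sign change, -f(left) ≤ f(right) - f(left) ≤ K width. Starting at 3
-- makes the root at least 3 without further work.
module Bisection (f : ℚ → ℚ) (K : ℚ) (0<K : 0ℚ < K)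
  (slope≤K : ∀ l h → 3ℚ ≤ l → l ≤ h → h ≤ 5ℚ → f h - f l ≤ K * (h - l))
  (f3≤0 : f 3ℚ ≤ 0ℚ) (0≤f5 : 0ℚ ≤ f 5ℚ) where

  left : ℕ → ℚ
  left ℕ.zero    = 3ℚ
  left (ℕ.suc n) with f (left n + width (ℕ.suc n)) ℚ.≤? 0ℚ
  ... | yes _ = left n + width (ℕ.suc n)
  ... | no  _ = left n

  left-mono : ∀ n → left n ≤ left (ℕ.suc n)
  left-mono n with f (left n + width (ℕ.suc n)) ℚ.≤? 0ℚ
  ... | yes _ = subst (_≤ left n + width (ℕ.suc n)) (ℚ.+-identityʳ (left n)) (ℚ.+-monoʳ-≤ (left n) (0≤width (ℕ.suc n)))
  ... | no  _ = ℚ.≤-refl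

  split-width : ∀ n → left n + width (ℕ.suc n) + width (ℕ.suc n) ≡ left n + width n
  split-width n = trans (ℚ.+-assoc (left n) (width (ℕ.suc n)) (width (ℕ.suc n)))
    (cong (_+_ (left n)) (halves (width n)))

  right-anti : ∀ n → left (ℕ.suc n) + width (ℕ.suc n) ≤ left n + width n
  right-anti n with f (left n + width (ℕ.suc n)) ℚ.≤? 0ℚ
  ... | yes _ = ℚ.≤-reflexive (split-width n)
  ... | no  _ = begin
    left n + width (ℕ.suc n)                      ≡⟨ ℚ.+-identityʳ _ ⟨
    left n + width (ℕ.suc n) + 0ℚ                 ≤⟨ ℚ.+-monoʳ-≤ (left n + width (ℕ.suc n)) (0≤width (ℕ.suc n)) ⟩
    left n + width (ℕ.suc n) + width (ℕ.suc n)    ≡⟨ split-width n ⟩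
    left n + width n                              ∎
    where open ℚ.≤-Reasoning

  f-left≤0 : ∀ n → f (left n) ≤ 0ℚ
  f-left≤0 ℕ.zero    = f3≤0
  f-left≤0 (ℕ.suc n) with f (left n + width (ℕ.suc n)) ℚ.≤? 0ℚ
  ... | yes f≤0 = f≤0
  ... | no  _   = f-left≤0 n

  0≤f-right : ∀ n → 0ℚ ≤ f (left n + width n)
  0≤f-right ℕ.zero    = 0≤f5
  0≤f-right (ℕ.suc n) with f (left n + width (ℕ.suc n)) ℚ.≤? 0ℚ
  ... | yes _   = subst (λ q → 0ℚ ≤ f q) (sym (split-width n)) (0≤f-right n)
  ... | no  f≰0 = ℚ.<⇒≤ (ℚ.≰⇒> f≰0)

  nested : ∀ N d → left N ≤ left (d ℕ.+ N) × left (d ℕ.+ N) + width (d ℕ.+ N) ≤ left N + width N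
  nested N ℕ.zero    = ℚ.≤-refl , ℚ.≤-refl
  nested N (ℕ.suc d) with lower , upper ← nested N d
    = ℚ.≤-trans lower (left-mono (d ℕ.+ N)) , ℚ.≤-trans (right-anti (d ℕ.+ N)) upper

  bracket : ∀ {N n} → N ℕ.≤ n → left N ≤ left n × left n + width n ≤ left N + width N
  bracket {N} {n} N≤n = subst (λ n → left N ≤ left n × left n + width n ≤ left N + width N)
    (ℕ.m∸n+n≡m N≤n) (nested N (n ℕ.∸ N))

  left≤right : ∀ n → left n ≤ left n + width n
  left≤right n = subst (_≤ left n + width n) (ℚ.+-identityʳ (left n)) (ℚ.+-monoʳ-≤ (left n) (0≤width n))

  left-cauchy : IsCauchy left
  left-cauchy ε 0<ε with N , h ← width→0 ε 0<ε = N , λ m n N≤m N≤n →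
    let lowerₘ , upperₘ = bracket N≤m
        lowerₙ , upperₙ = bracket N≤n
    in ℚ.≤-<-trans (∣x-y∣≤w {left m} {left n} {left N} {width N} lowerₘ (ℚ.≤-trans (left≤right m) upperₘ)
                            lowerₙ (ℚ.≤-trans (left≤right n) upperₙ))
                   (h N ℕ.≤-refl)

  root : ℝ
  root = mkℝ left left-cauchy

  3≤root : fromℚ 3ℚ ≤ᵣ root
  3≤root ε 0<ε = 0 , λ n _ → ℚ.≤-<-trans
    (ℚ.≤-trans (ℚ.+-monoˡ-≤ (- left n) (proj₁ (bracket {0} {n} ℕ.z≤n))) (ℚ.≤-reflexive (ℚ.+-inverseʳ (left n))))
    0<ε

  ∣f-left∣≤ : ∀ n → ℚ.∣ f (left n) ∣ ≤ K * width n
  ∣f-left∣≤ n = begin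
    ℚ.∣ f (left n) ∣                         ≡⟨ ℚ.∣-p∣≡∣p∣ (f (left n)) ⟨
    ℚ.∣ - f (left n) ∣                       ≡⟨ ℚ.0≤p⇒∣p∣≡p (ℚ.neg-antimono-≤ (f-left≤0 n)) ⟩
    - f (left n)                             ≡⟨ ℚ.+-identityˡ (- f (left n)) ⟨
    0ℚ - f (left n)                          ≤⟨ ℚ.+-monoˡ-≤ (- f (left n)) (0≤f-right n) ⟩
    f (left n + width n) - f (left n)        ≤⟨ slope≤K (left n) (left n + width n)
                                                  (proj₁ (bracket {0} {n} ℕ.z≤n)) (left≤right n)
                                                  (proj₂ (bracket {0} {n} ℕ.z≤n)) ⟩
    K * (left n + width n - left n)          ≡⟨ cong (_*_ K) (solve 2 (λ l w → l :+ w :- l := w) refl (left n) (width n)) ⟩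
    K * width n                              ∎
    where open ℚ.≤-Reasoning

  Null-f-root : Null (f ∘ left)
  Null-f-root ε 0<ε with η , 0<η , K*η≡ε ← quotient 0<K 0<ε with N , h ← width→0 η 0<η
    = N , λ n N≤n → ℚ.≤-<-trans (∣f-left∣≤ n)
        (subst (K * width n <_) K*η≡ε (ℚ.*-monoʳ-<-pos K {{ℚ.positive 0<K}} (h n N≤n)))

cubic : (f₀ f₁ f₂ f₃ : ℚ) → ℚ → ℚ
cubic f₀ f₁ f₂ f₃ q = f₀ + (f₁ + (f₂ + f₃ * q) * q) * q

module _ (f₀ f₁ f₂ f₃ : ℚ) where
  private
    f = cubic f₀ f₁ f₂ f₃

    -- On [3 , 5] the divided difference f₁ + f₂ (h + l) + f₃ (h² + h l + l²) is at most K.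
    K : ℚ
    K = (1ℚ + ℚ.∣ f₁ ∣) + (ℚ.∣ f₂ ∣ * (5ℚ + 5ℚ) + ℚ.∣ f₃ ∣ * (5ℚ * 5ℚ + 5ℚ * 5ℚ + 5ℚ * 5ℚ))

    0≤*0≤ : ∀ {p q} → 0ℚ ≤ p → 0ℚ ≤ q → 0ℚ ≤ p * q
    0≤*0≤ {p} {q} 0≤p 0≤q = subst (_≤ p * q) (ℚ.*-zeroʳ p) (ℚ.*-monoˡ-≤-nonNeg p {{ℚ.nonNegative 0≤p}} 0≤q)

    p*q≤∣p∣*r : ∀ p {q r} → 0ℚ ≤ q → q ≤ r → p * q ≤ ℚ.∣ p ∣ * r
    p*q≤∣p∣*r p {q} {r} 0≤q q≤r = ℚ.≤-trans
      (ℚ.*-monoʳ-≤-nonNeg q {{ℚ.nonNegative 0≤q}} (p≤∣p∣ p))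
      (ℚ.*-monoˡ-≤-nonNeg ℚ.∣ p ∣ {{ℚ.∣-∣-nonNeg p}} q≤r)

    *-mono-≤5 : ∀ {p q} → 0ℚ ≤ p → p ≤ 5ℚ → q ≤ 5ℚ → p * q ≤ 5ℚ * 5ℚ
    *-mono-≤5 {p} 0≤p p≤5 q≤5 = ℚ.≤-trans
      (ℚ.*-monoˡ-≤-nonNeg p {{ℚ.nonNegative 0≤p}} q≤5)
      (ℚ.*-monoʳ-≤-nonNeg 5ℚ p≤5)

    slope≤K : ∀ l h → 3ℚ ≤ l → l ≤ h → h ≤ 5ℚ → f h - f l ≤ K * (h - l)
    slope≤K l h 3≤l l≤h h≤5 = begin
      f h - f l
        -- The summand 0 is put where K has its 1, so that the two sums compare term by term; the 1
        -- keeps K positive.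
        ≡⟨ solve 6 (λ a b c d l h →
             (a :+ (b :+ (c :+ d :* h) :* h) :* h) :- (a :+ (b :+ (c :+ d :* l) :* l) :* l) :=
             ((con 0ℚ :+ b) :+ (c :* (h :+ l) :+ d :* (h :* h :+ h :* l :+ l :* l))) :* (h :- l))
             refl f₀ f₁ f₂ f₃ l h ⟩
      ((0ℚ + f₁) + (f₂ * (h + l) + f₃ * (h * h + h * l + l * l))) * (h - l)
        ≤⟨ ℚ.*-monoʳ-≤-nonNeg (h - l) {{ℚ.nonNegative 0≤h-l}}
             (ℚ.+-mono-≤ (ℚ.+-mono-≤ (from-yes (0ℚ ℚ.≤? 1ℚ)) (p≤∣p∣ f₁)) (ℚ.+-mono-≤
               (p*q≤∣p∣*r f₂ (ℚ.+-mono-≤ 0≤h 0≤l) (ℚ.+-mono-≤ h≤5 l≤5))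
               (p*q≤∣p∣*r f₃
                 (ℚ.+-mono-≤ (ℚ.+-mono-≤ (0≤*0≤ 0≤h 0≤h) (0≤*0≤ 0≤h 0≤l)) (0≤*0≤ 0≤l 0≤l))
                 (ℚ.+-mono-≤ (ℚ.+-mono-≤ (*-mono-≤5 0≤h h≤5 h≤5) (*-mono-≤5 0≤h h≤5 l≤5)) (*-mono-≤5 0≤l l≤5 l≤5))))) ⟩
      K * (h - l) ∎
      where
      open ℚ.≤-Reasoning
      l≤5 = ℚ.≤-trans l≤h h≤5
      0≤l = ℚ.≤-trans (from-yes (0ℚ ℚ.≤? 3ℚ)) 3≤l
      0≤h = ℚ.≤-trans 0≤l l≤h
      0≤h-l : 0ℚ ≤ h - l
      0≤h-l = subst (_≤ h - l) (ℚ.+-inverseʳ l) (ℚ.+-monoˡ-≤ (- l) l≤h)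

    0<K : 0ℚ < K
    0<K = ℚ.+-mono-<-≤ (ℚ.+-mono-<-≤ (ℚ.positive⁻¹ 1ℚ) (ℚ.0≤∣p∣ f₁))
      (ℚ.+-mono-≤ (0≤*0≤ (ℚ.0≤∣p∣ f₂) (from-yes (0ℚ ℚ.≤? 5ℚ + 5ℚ)))
                  (0≤*0≤ (ℚ.0≤∣p∣ f₃) (from-yes (0ℚ ℚ.≤? 5ℚ * 5ℚ + 5ℚ * 5ℚ + 5ℚ * 5ℚ))))

  abstract
    cubicRoot : f 3ℚ ≤ 0ℚ → 0ℚ ≤ f 5ℚ → ∃ λ ρ → fromℚ 3ℚ ≤ᵣ ρ × Null (λ k → f (seq ρ k))
    cubicRoot f3≤0 0≤f5 = root , 3≤root , Null-f-root
      where open Bisection f K 0<K slope≤K f3≤0 0≤f5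

-- Modifications of two small cliques

twoCliques : ∀ k l → Fin (k ℕ.+ l) → Fin 2
twoCliques k l = [ const 0F , const 1F ]′ ∘ splitAt k

placement : ∀ {n k l} → Vec (Fin n) k → Vec (Fin n) l → Fin (k ℕ.+ l) → Fin n
placement {k = k} xs ys = [ lookup xs , lookup ys ]′ ∘ splitAt k

module _ {n p k l} {c : Fin n → Fin p} {D E : Fin p} {xs : Vec (Fin n) k} {ys : Vec (Fin n) l}
         (D≢E : D ≢ E) (xs-D : Enumerates c D xs) (ys-E : Enumerates c E ys) where
  private
    module X = Enumerates xs-D
    module Y = Enumerates ys-E

    place : Fin k ⊎ Fin l → Fin n
    place = [ lookup xs , lookup ys ]′

    clique : Fin k ⊎ Fin l → Fin 2
    clique = [ const 0F , const 1F ]′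

    xs⊆D : ∀ s → c (lookup xs s) ≡ D
    xs⊆D = All.lookup⁺ X.within

    ys⊆E : ∀ s → c (lookup ys s) ≡ E
    ys⊆E = All.lookup⁺ Y.within

    place-injective : ∀ s t → place s ≡ place t → s ≡ t
    place-injective (inj₁ s) (inj₁ t) eq = cong inj₁ (lookup-injective X.unique s t eq)
    place-injective (inj₁ s) (inj₂ t) eq = contradiction (trans (sym (xs⊆D s)) (trans (cong c eq) (ys⊆E t))) D≢E
    place-injective (inj₂ s) (inj₁ t) eq = contradiction (trans (sym (xs⊆D t)) (trans (cong c (sym eq)) (ys⊆E s))) D≢E
    place-injective (inj₂ s) (inj₂ t) eq = cong inj₂ (lookup-injective Y.unique s t eq)

    place-classes : ∀ s t → c (place s) ≡ c (place t) ⇔ clique s ≡ clique t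
    place-classes (inj₁ s) (inj₁ t) = mk⇔ (λ _ → refl) (λ _ → trans (xs⊆D s) (sym (xs⊆D t)))
    place-classes (inj₁ s) (inj₂ t) = mk⇔ (λ eq → contradiction (trans (sym (xs⊆D s)) (trans eq (ys⊆E t))) D≢E) (λ ())
    place-classes (inj₂ s) (inj₁ t) = mk⇔ (λ eq → contradiction (trans (sym (xs⊆D t)) (trans (sym eq) (ys⊆E s))) D≢E) (λ ())
    place-classes (inj₂ s) (inj₂ t) = mk⇔ (λ _ → refl) (λ _ → trans (ys⊆E s) (sym (ys⊆E t)))

    splitAt-injective : ∀ s t → splitAt k s ≡ splitAt k t → s ≡ t
    splitAt-injective s t eq =
      trans (sym (join-splitAt k l s)) (trans (cong (join k l) eq) (join-splitAt k l t))

    place-closed : ∀ t j → c j ≡ c (place t) → ∃ λ s → place s ≡ j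
    place-closed (inj₁ t) j cj≡ with s , eq ← X.complete j (trans cj≡ (xs⊆D t)) = inj₁ s , eq
    place-closed (inj₂ t) j cj≡ with s , eq ← Y.complete j (trans cj≡ (ys⊆E t)) = inj₂ s , eq

  placement-embedding : ClosedEmbedding (twoCliques k l) c (placement xs ys)
  placement-embedding = record
    { injective = λ {s} {t} eq → splitAt-injective s t (place-injective (splitAt k s) (splitAt k t) eq)
    ; classes   = λ s t → place-classes (splitAt k s) (splitAt k t)
    ; closed    = λ t j cj≡ → let s , eq = place-closed (splitAt k t) j cj≡ in
        join k l s , trans (cong place (splitAt-join k l s)) eq
    }

module _ {n p} {c : Fin n → Fin p} {a b u v : Fin n} where

  weaken : ∀ {m m′} → m ℕ.≤ m′ → LargeEigenpair c a b u v m′ → LargeEigenpair c a b u v m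
  weaken {m} {m′} m≤m′ e = record
    { LargeEigenpair e
    ; large = λ ε 0<ε → let N , h = LargeEigenpair.large e ε 0<ε in
        N , λ k N≤k → ℚ.≤-<-trans (ℚ.+-monoˡ-≤ (- seq (LargeEigenpair.value e) k) (/1-mono-≤ m≤m′)) (h k N≤k)
    }

  computedEigenpair : ∀ (y : Vec ℚ n) r → (∀ i → surgeryOp c a b u v (lookup y) i ≡ + r / 1 * lookup y i) →
    ∀ i → lookup y i ≢ 0ℚ → LargeEigenpair c a b u v r
  computedEigenpair y r eigen i yi≢0 = exactEigenpair {m = r} (lookup y) (+ r / 1) eigen i yi≢0 ℚ.≤-refl

-- Eigenvectors with coordinates in the field of a cubic root

0<1+∣_∣ : ∀ q → 0ℚ < 1ℚ + ℚ.∣ q ∣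
0<1+∣ q ∣ = ℚ.+-mono-<-≤ (ℚ.positive⁻¹ 1ℚ) (ℚ.0≤∣p∣ q)

Null-* : ∀ q {f} → Null f → Null (λ n → q * f n)
Null-* q {f} f→0 ε 0<ε
  with η , 0<η , B*η≡ε ← quotient (0<1+∣ q ∣) 0<ε
  with N , h ← f→0 η 0<η
  = N , λ n N≤n → subst (ℚ.∣ q * f n ∣ <_) B*η≡ε
      (∣*∣-bound q (f n) (0<1+∣ q ∣) (ℚ.≤-trans (ℚ.≤-reflexive (sym (ℚ.+-identityˡ ℚ.∣ q ∣)))
        (ℚ.+-monoˡ-≤ ℚ.∣ q ∣ (ℚ.<⇒≤ (ℚ.positive⁻¹ 1ℚ)))) (h n N≤n))

-- A triple is a residue modulo the cubic. It is read as a rational function here, then as a real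
-- and as solver syntax; the three readings have the same shape, so they agree by computation.
quadratic : ℚ × ℚ × ℚ → ℚ → ℚ
quadratic (y₀ , y₁ , y₂) q = y₀ + (y₁ + y₂ * q) * q

quadraticℝ : ℚ × ℚ × ℚ → ℝ → ℝ
quadraticℝ (y₀ , y₁ , y₂) ρ = fromℚ y₀ +ᵣ (fromℚ y₁ +ᵣ fromℚ y₂ *ᵣ ρ) *ᵣ ρ

quadraticPoly : ℚ × ℚ × ℚ → Polynomial 1 → Polynomial 1
quadraticPoly (y₀ , y₁ , y₂) q = con y₀ :+ (con y₁ :+ con y₂ :* q) :* q

cubicPoly : (f₀ f₁ f₂ f₃ : ℚ) → Polynomial 1 → Polynomial 1
cubicPoly f₀ f₁ f₂ f₃ q = con f₀ :+ (con f₁ :+ (con f₂ :+ con f₃ :* q) :* q) :* q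

-- The syntax of surgeryOp, so that the ring solver can be run on a concrete instance of it.
module _ {n p} (c : Fin n → Fin p) (a b u v : Fin n) (y : Fin n → Polynomial 1) (i : Fin n) where
  private
    δPoly : ∀ {m} → Fin m → Fin m → Polynomial 1
    δPoly i j = con (δ i j)

    edgePoly : Fin n → Fin n → Polynomial 1
    edgePoly a b = (y a :- y b) :* (δPoly a i :- δPoly b i)

  surgeryPoly : Polynomial 1
  surgeryPoly = foldr _:+_ (con 0ℚ) (λ j → δPoly (c j) (c i) :* (y i :- y j))
    :- edgePoly a b :+ edgePoly u v

module _ {n p} {c : Fin n → Fin p} {a b u v : Fin n} where

  -- The coordinates y are quadratics in the eigenvalue ρ, a root of the cubic f; the
  -- eigenvalue equations hold modulo f, with cofactors κ.
  algebraicEigenpair : ∀ (f₀ f₁ f₂ f₃ : ℚ) (y : Vec (ℚ × ℚ × ℚ) n) (κ : Vec ℚ n) →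
    cubic f₀ f₁ f₂ f₃ 3ℚ ≤ 0ℚ → 0ℚ ≤ cubic f₀ f₁ f₂ f₃ 5ℚ →
    (∀ i q → surgeryOp c a b u v (λ j → quadratic (lookup y j) q) i - q * quadratic (lookup y i) q
             ≡ lookup κ i * cubic f₀ f₁ f₂ f₃ q) →
    ∀ i → lookup y i ≡ (1ℚ , 0ℚ , 0ℚ) → LargeEigenpair c a b u v 3
  algebraicEigenpair f₀ f₁ f₂ f₃ y κ f3≤0 0≤f5 eigen i yi≡1
    with ρ , 3≤ρ , fρ→0 ← cubicRoot f₀ f₁ f₂ f₃ f3≤0 0≤f5
    = largeEigenpair ρ (λ j → quadraticℝ (lookup y j) ρ) (i , yi≄0)
        (λ j → Null-cong (λ k → sym (eigen j (seq ρ k))) (Null-* (lookup κ j) fρ→0)) 3≤ρ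
    where
    -- A coordinate that is constantly 1 is non-zero whatever ρ is; the vectors below are therefore
    -- normalised at a leaf.
    yi≄0 : ¬ quadraticℝ (lookup y i) ρ ≃ 0ℝ
    yi≄0 yi≃0 with N , h ← yi≃0 1ℚ (ℚ.positive⁻¹ 1ℚ)
      = ℚ.<-irrefl (cong (λ r → ℚ.∣ r - 0ℚ ∣) (trans
          (cong (λ t → quadratic t (seq ρ N)) yi≡1)
          (solve 1 (λ q → con 1ℚ :+ (con 0ℚ :+ con 0ℚ :* q) :* q := con 1ℚ) refl (seq ρ N))))
        (h N ℕ.≤-refl)

-- The small models

small-1-1 : LargeEigenpair (twoCliques 1 1) 0F 0F 0F 1F 2
small-1-1 = computedEigenpair (1ℚ ∷ - 1ℚ ∷ []) 2 (λ { 0F → refl ; 1F → refl }) 0F λ ()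

small-2-1 : LargeEigenpair (twoCliques 2 1) 0F 0F 0F 2F 3
small-2-1 = computedEigenpair (- 2ℚ ∷ 1ℚ ∷ 1ℚ ∷ []) 3 (λ { 0F → refl ; 1F → refl ; 2F → refl }) 1F λ ()

-- The edge moves from 01 to 02: a K₂ remains, and vertex 1 is isolated.
small-2-1-removed : LargeEigenpair (twoCliques 2 1) 0F 1F 0F 2F 2
small-2-1-removed = computedEigenpair (1ℚ ∷ 0ℚ ∷ - 1ℚ ∷ []) 2
  (λ { 0F → refl ; 1F → refl ; 2F → refl }) 0F λ ()

-- P₄ as 1 - 0 - 2 - 3. Its rational eigenvalue 2 is not its largest, but it is used only for m ≤ 2.
small-2-2 : LargeEigenpair (twoCliques 2 2) 0F 0F 0F 2F 2
small-2-2 = computedEigenpair (1ℚ ∷ - 1ℚ ∷ 1ℚ ∷ - 1ℚ ∷ []) 2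
  (λ { 0F → refl ; 1F → refl ; 2F → refl ; 3F → refl }) 0F λ ()

small-2-2-removed : LargeEigenpair (twoCliques 2 2) 0F 1F 0F 2F 3
small-2-2-removed = computedEigenpair (1ℚ ∷ 0ℚ ∷ - 2ℚ ∷ 1ℚ ∷ []) 3
  (λ { 0F → refl ; 1F → refl ; 2F → refl ; 3F → refl }) 0F λ ()

star : LargeEigenpair (twoCliques 3 1) 0F 1F 2F 3F 4
star = computedEigenpair (- 1ℚ ∷ - 1ℚ ∷ 3ℚ ∷ - 1ℚ ∷ []) 4
  (λ { 0F → refl ; 1F → refl ; 2F → refl ; 3F → refl }) 2F λ ()

-- P₄ as 1 - 2 - 0 - 3, with ρ = 2 + √2 a root of q² - 4q + 2. From the value 1 at leaf 1 each row
-- of the eigenvalue equation yields the next coordinate, reduced modulo this polynomial.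
path₄ : LargeEigenpair (twoCliques 3 1) 0F 1F 0F 3F 3
path₄ = algebraicEigenpair f₀ f₁ f₂ f₃ y κ 
  (from-yes (cubic f₀ f₁ f₂ f₃ 3ℚ ℚ.≤? 0ℚ)) (from-yes (0ℚ ℚ.≤? cubic f₀ f₁ f₂ f₃ 5ℚ))
  (λ { 0F → solve 1 (eq 0F) refl ; 1F → solve 1 (eq 1F) refl
     ; 2F → solve 1 (eq 2F) refl ; 3F → solve 1 (eq 3F) refl })
  1F refl
  where
  f₀ f₁ f₂ f₃ : ℚ
  f₀ = 2ℚ
  f₁ = - (+ 4 / 1)
  f₂ = 1ℚ
  f₃ = 0ℚ
  y = (- 1ℚ , 1ℚ , 0ℚ) ∷ (1ℚ , 0ℚ , 0ℚ) ∷ (1ℚ , - 1ℚ , 0ℚ) ∷ (- 1ℚ , 0ℚ , 0ℚ) ∷ []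
  κ = - 1ℚ ∷ 0ℚ ∷ 1ℚ ∷ 0ℚ ∷ []
  eq : Fin 4 → Polynomial 1 → Polynomial 1 × Polynomial 1
  eq i q = surgeryPoly (twoCliques 3 1) 0F 1F 0F 3F (λ j → quadraticPoly (lookup y j) q) i
      :- q :* quadraticPoly (lookup y i) q
    := con (lookup κ i) :* cubicPoly f₀ f₁ f₂ f₃ q

-- P₅ as 1 - 2 - 0 - 3 - 4, with ρ = (5 + √5)/2 a root of q² - 5q + 5; the vector is symmetric about
-- the middle vertex 0.
path₅ : LargeEigenpair (twoCliques 3 2) 0F 1F 0F 3F 3
path₅ = algebraicEigenpair f₀ f₁ f₂ f₃ y κ 
  (from-yes (cubic f₀ f₁ f₂ f₃ 3ℚ ℚ.≤? 0ℚ)) (from-yes (0ℚ ℚ.≤? cubic f₀ f₁ f₂ f₃ 5ℚ))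
  (λ { 0F → solve 1 (eq 0F) refl ; 1F → solve 1 (eq 1F) refl
     ; 2F → solve 1 (eq 2F) refl ; 3F → solve 1 (eq 3F) refl ; 4F → solve 1 (eq 4F) refl })
  1F refl
  where
  f₀ f₁ f₂ f₃ : ℚ
  f₀ = 5ℚ
  f₁ = - 5ℚ
  f₂ = 1ℚ
  f₃ = 0ℚ
  y = (- (+ 4 / 1) , 2ℚ , 0ℚ) ∷ (1ℚ , 0ℚ , 0ℚ) ∷ (1ℚ , - 1ℚ , 0ℚ)
    ∷ (1ℚ , - 1ℚ , 0ℚ) ∷ (1ℚ , 0ℚ , 0ℚ) ∷ []
  κ = - 2ℚ ∷ 0ℚ ∷ 1ℚ ∷ 1ℚ ∷ 0ℚ ∷ []
  eq : Fin 5 → Polynomial 1 → Polynomial 1 × Polynomial 1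
  eq i q = surgeryPoly (twoCliques 3 2) 0F 1F 0F 3F (λ j → quadraticPoly (lookup y j) q) i
      :- q :* quadraticPoly (lookup y i) q
    := con (lookup κ i) :* cubicPoly f₀ f₁ f₂ f₃ q

-- Centre 2, leaves 0 and 1, leg 3 - 4. The vector e_0 - e_1 has eigenvalue 1; on the vectors
-- symmetric in 0 and 1 the characteristic polynomial is q times the cubic used here. Coordinates
-- are found from the leaf 4 inwards.
spider : LargeEigenpair (twoCliques 3 2) 0F 1F 2F 3F 3
spider = algebraicEigenpair f₀ f₁ f₂ f₃ y κ 
  (from-yes (cubic f₀ f₁ f₂ f₃ 3ℚ ℚ.≤? 0ℚ)) (from-yes (0ℚ ℚ.≤? cubic f₀ f₁ f₂ f₃ 5ℚ))
  (λ { 0F → solve 1 (eq 0F) refl ; 1F → solve 1 (eq 1F) refl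
     ; 2F → solve 1 (eq 2F) refl ; 3F → solve 1 (eq 3F) refl ; 4F → solve 1 (eq 4F) refl })
  4F refl
  where
  f₀ f₁ f₂ f₃ : ℚ
  f₀ = - 5ℚ
  f₁ = + 13 / 1
  f₂ = - (+ 7 / 1)
  f₃ = 1ℚ
  y = (- (+ 3 / 2) , 2ℚ , - ½) ∷ (- (+ 3 / 2) , 2ℚ , - ½) ∷ (1ℚ , - 3ℚ , 1ℚ)
    ∷ (1ℚ , - 1ℚ , 0ℚ) ∷ (1ℚ , 0ℚ , 0ℚ) ∷ []
  κ = ½ ∷ ½ ∷ - 1ℚ ∷ 0ℚ ∷ 0ℚ ∷ []
  eq : Fin 5 → Polynomial 1 → Polynomial 1 × Polynomial 1
  eq i q = surgeryPoly (twoCliques 3 2) 0F 1F 2F 3F (λ j → quadraticPoly (lookup y j) q) i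
      :- q :* quadraticPoly (lookup y i) q
    := con (lookup κ i) :* cubicPoly f₀ f₁ f₂ f₃ q

-- A large eigenvalue after every modification

module _ {n} {x z : Fin n} where

  twins-off : ∀ {i} → x ≢ i → z ≢ i → twins x z i ≡ 0ℚ
  twins-off x≢i z≢i rewrite δ-≢ x≢i | δ-≢ z≢i = refl

  twins-at : x ≢ z → twins x z x ≡ 1ℚ
  twins-at x≢z rewrite δ-refl x | δ-≢ (≢-sym x≢z) = refl

1ℚ≢0ℚ : 1ℚ ≢ 0ℚ
1ℚ≢0ℚ ()

Avoids : ∀ {n k} → Vec (Fin n) k → Fin n → Set
Avoids xs x = All (x ≢_) xs

module _ {n p} (c : Fin n → Fin p) (m : ℕ) where
  private
    size : Fin p → ℕ
    size = componentSize c

  pairAvoiding : ∀ {k} D (xs : Vec (Fin n) k) → ℕ.suc k ℕ.< size D →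
    ∃ λ x → ∃ λ z → x ≢ z × c x ≡ D × c z ≡ D × Avoids xs x × Avoids xs z
  pairAvoiding D xs 1+k<
    with x , cx≡D , x≢xs ← another c D xs (ℕ.<-trans (ℕ.n<1+n _) 1+k<)
    with z , cz≡D , z≢x ∷ z≢xs ← another c D (x ∷ xs) 1+k<
    = x , z , ≢-sym z≢x , cx≡D , cz≡D , x≢xs , z≢xs

  apart : ∀ {D x y} → c x ≡ D → c y ≢ D → x ≢ y
  apart cx≡D cy≢D refl = cy≢D cx≡D

  twinEigenpair : ∀ {a b u v D x z} → size D ≡ m → x ≢ z → c x ≡ D → c z ≡ D →
    twins x z a ≡ twins x z b → twins x z u ≡ twins x z v → LargeEigenpair c a b u v m
  twinEigenpair {D = D} {x} {z} size≡m x≢z refl cz≡D ab uv =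
    balancedEigenpair c m (twins x z) (CliqueEigenvector-twins c m x z (sym cz≡D) size≡m) ab uv x
      (λ eq → 1ℚ≢0ℚ (trans (sym (twins-at x≢z)) eq))

  -- With the edge ab removed from a clique, δ a + δ b - 2 δ z takes equal values at a and b.
  forkEigenpair : ∀ {a b u v D z} → size D ≡ m → a ≢ b → c a ≡ D → c b ≡ D → c z ≡ D →
    z ≢ a → z ≢ b → (∀ {x} → x ≡ u ⊎ x ≡ v → x ≢ a × x ≢ b × x ≢ z) ⊎ u ≡ v → LargeEigenpair c a b u v m
  forkEigenpair {a} {b} {u} {v} {z = z} size≡m a≢b refl cb≡ cz≡ z≢a z≢b uv =
    balancedEigenpair c m y
      (CliqueEigenvector-+ c m (twins a z) (twins b z)
        (CliqueEigenvector-twins c m a z (sym cz≡) size≡m)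
        (CliqueEigenvector-twins c m b z (trans cb≡ (sym cz≡)) (trans (cong size cb≡) size≡m)))
      (trans ya≡1 (sym yb≡1)) ([ (λ off → trans (yx≡0 (off (inj₁ refl))) (sym (yx≡0 (off (inj₂ refl))))) , cong y ]′ uv)
      a (λ eq → 1ℚ≢0ℚ (trans (sym ya≡1) eq))
    where
    y : Fin n → ℚ
    y i = twins a z i + twins b z i
    ya≡1 : y a ≡ 1ℚ
    ya≡1 = cong₂ _+_ (twins-at (≢-sym z≢a)) (twins-off (≢-sym a≢b) z≢a)
    yb≡1 : y b ≡ 1ℚ
    yb≡1 = cong₂ _+_ (twins-off a≢b z≢b) (twins-at (≢-sym z≢b))
    yx≡0 : ∀ {x} → x ≢ a × x ≢ b × x ≢ z → y x ≡ 0ℚ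
    yx≡0 (x≢a , x≢b , x≢z) = cong₂ _+_ (twins-off (≢-sym x≢a) (≢-sym x≢z)) (twins-off (≢-sym x≢b) (≢-sym x≢z))

  cliqueAround : ∀ v → size (c v) ℕ.≤ 2 →
    Enumerates c (c v) (v ∷ []) ⊎ ∃ λ w → Enumerates c (c v) (v ∷ w ∷ [])
  cliqueAround v size≤2 with size (c v) ℕ.≤? 1
  ... | yes size≤1 = inj₁ (enumerate c (c v) ([] ∷ []) (refl ∷ []) size≤1)
  ... | no  size≰1 with w , cw≡cv , w≢v ∷ [] ← another c (c v) (v ∷ []) (ℕ.≰⇒> size≰1)
    = inj₂ (w , enumerate c (c v) ((≢-sym w≢v ∷ []) ∷ [] ∷ []) (refl ∷ cw≡cv ∷ []) size≤2)

  pairClique : ∀ {a b} → a ≢ b → c a ≡ c b → size (c a) ℕ.≤ 2 → Enumerates c (c a) (a ∷ b ∷ [])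
  pairClique a≢b ca≡cb size≤2 = enumerate c _ ((a≢b ∷ []) ∷ [] ∷ []) (refl ∷ sym ca≡cb ∷ []) size≤2

  pairClique-complete : ∀ {a b} → Enumerates c (c a) (a ∷ b ∷ []) → ∀ {x} → c x ≡ c a → x ≡ a ⊎ x ≡ b
  pairClique-complete ab cx≡ca with Enumerates.complete ab _ cx≡ca
  ... | 0F , a≡x = inj₁ (sym a≡x)
  ... | 1F , b≡x = inj₂ (sym b≡x)

  module _ (size≤m : ∀ D → size D ℕ.≤ m) where

    -- For m ≤ 2 the second edge xz is a K₂ disjoint from ab and keeps the eigenvalue 2. For m ≥ 3
    -- the vector lives on D: twins if ab lies elsewhere, otherwise a fork through a third vertex of
    -- D.
    removalEigenpair : ∀ {a b x z} u D → size D ≡ m → a ≢ b → c a ≡ c b →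
      x ≢ z → c x ≡ c z → ¬ SamePair a b x z → LargeEigenpair c a b u u m
    removalEigenpair {a} {b} {x} {z} u D size≡m a≢b ca≡cb x≢z cx≡cz ¬sp with m ℕ.≤? 2 | c a ≟ D
    ... | yes m≤2 | _ = twinEigenpair size-x≡m x≢z refl (sym cx≡cz)
        (trans (twins-off (apart refl ca≢cx) (apart (sym cx≡cz) ca≢cx))
          (sym (twins-off (apart refl cb≢cx) (apart (sym cx≡cz) cb≢cx)))) refl
      where
      size-x≡m : size (c x) ≡ m
      size-x≡m = ℕ.≤-antisym (size≤m (c x)) (ℕ.≤-trans m≤2
        (length≤componentSize c (c x) ((x≢z ∷ []) ∷ [] ∷ []) (refl ∷ sym cx≡cz ∷ [])))
      ca≢cx : c a ≢ c x
      ca≢cx ca≡cx = [ (λ x≡a → [ (λ z≡a → x≢z (trans x≡a (sym z≡a))) , (λ z≡b → ¬sp (inj₁ (x≡a , z≡b))) ]′ z∈ab)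
                    , (λ x≡b → [ (λ z≡a → ¬sp (inj₂ (x≡b , z≡a))) , (λ z≡b → x≢z (trans x≡b (sym z≡b))) ]′ z∈ab) ]′ x∈ab
        where
        ab = pairClique a≢b ca≡cb (ℕ.≤-trans (size≤m (c a)) m≤2)
        x∈ab = pairClique-complete ab (sym ca≡cx)
        z∈ab = pairClique-complete ab (trans (sym cx≡cz) (sym ca≡cx))
      cb≢cx : c b ≢ c x
      cb≢cx cb≡cx = ca≢cx (trans ca≡cb cb≡cx)
    ... | no m≰2 | no ca≢D
      with x , z , x≢z , cx≡D , cz≡D , _ ← pairAvoiding D [] (subst (1 ℕ.<_) (sym size≡m) (ℕ.<-trans (ℕ.n<1+n 1) (ℕ.≰⇒> m≰2)))
      = twinEigenpair size≡m x≢z cx≡D cz≡D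
        (trans (twins-off (apart cx≡D ca≢D) (apart cz≡D ca≢D))
          (sym (twins-off (apart cx≡D cb≢D) (apart cz≡D cb≢D)))) refl
      where
      cb≢D : c b ≢ D
      cb≢D cb≡D = ca≢D (trans ca≡cb cb≡D)
    ... | no m≰2 | yes ca≡D
      with z , cz≡D , z≢a ∷ z≢b ∷ [] ← another c D (a ∷ b ∷ []) (subst (2 ℕ.<_) (sym size≡m) (ℕ.≰⇒> m≰2))
      = forkEigenpair size≡m a≢b ca≡D (trans (sym ca≡cb) ca≡D) cz≡D z≢a z≢b (inj₂ refl)

    -- No edge is removed, or it is removed from a clique that the new edge does not touch.
    Inactive : (a b u v : Fin n) → Set
    Inactive a b u v = a ≡ b ⊎ (c a ≡ c b × c a ≢ c u × c a ≢ c v)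

    inactive-represents : ∀ {a b u v k l} {xs : Vec (Fin n) k} {ys : Vec (Fin n) l} →
      Inactive a b u v → Enumerates c (c u) xs → Enumerates c (c v) ys →
      ∀ α → Represents (placement xs ys) a b α α
    inactive-represents (inj₁ a≡b) U V α = equal a≡b refl
    inactive-represents {u = u} {v} {k} {xs = xs} {ys} (inj₂ (ca≡cb , ca≢cu , ca≢cv)) U V α =
      outside (away ca≢cu ca≢cv) (away (ca≢cu ∘ trans ca≡cb) (ca≢cv ∘ trans ca≡cb)) refl
      where
      away : ∀ {x} → c x ≢ c u → c x ≢ c v → ∀ t → placement xs ys t ≢ x
      away cx≢cu cx≢cv t with splitAt k t
      ... | inj₁ s = apart (All.lookup⁺ (Enumerates.within U) s) cx≢cu
      ... | inj₂ s = apart (All.lookup⁺ (Enumerates.within V) s) cx≢cv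

    module _ (m≤2 : m ℕ.≤ 2) where
      private
        size≤2 : ∀ D → size D ℕ.≤ 2
        size≤2 D = ℕ.≤-trans (size≤m D) m≤2

        m≤3 : m ℕ.≤ 3
        m≤3 = ℕ.m≤n⇒m≤1+n m≤2

      inactiveEigenpair : ∀ {a b u v} → c u ≢ c v → Inactive a b u v → LargeEigenpair c a b u v m
      inactiveEigenpair {u = u} {v} cu≢cv inactive with cliqueAround u (size≤2 (c u)) | cliqueAround v (size≤2 (c v))
      ... | inj₁ U       | inj₁ V       = weaken m≤2 (embedEigenpair (placement-embedding cu≢cv U V)
              (inactive-represents inactive U V 0F) (inside refl refl) small-1-1)
      ... | inj₂ (_ , U) | inj₁ V       = weaken m≤3 (embedEigenpair (placement-embedding cu≢cv U V)
              (inactive-represents inactive U V 0F) (inside refl refl) small-2-1)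
      ... | inj₂ (_ , U) | inj₂ (_ , V) = weaken m≤2 (embedEigenpair (placement-embedding cu≢cv U V)
              (inactive-represents inactive U V 0F) (inside refl refl) small-2-2)
      ... | inj₁ U       | inj₂ (_ , V) = swap-added (weaken m≤3 (embedEigenpair
              (placement-embedding (≢-sym cu≢cv) V U)
              (inactive-represents (Sum.map₂ (λ (eq , ca≢cu , ca≢cv) → eq , ca≢cv , ca≢cu) inactive) V U 0F)
              (inside refl refl) small-2-1))

      detachedEigenpair : ∀ {a b v} → a ≢ b → c a ≡ c b → c a ≢ c v → LargeEigenpair c a b a v m
      detachedEigenpair {a} {b} {v} a≢b ca≡cb ca≢cv with cliqueAround v (size≤2 (c v))
      ... | inj₁ V       = weaken m≤2 (embedEigenpair
              (placement-embedding ca≢cv (pairClique a≢b ca≡cb (size≤2 (c a))) V)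
              (inside refl refl) (inside refl refl) small-2-1-removed)
      ... | inj₂ (_ , V) = weaken m≤3 (embedEigenpair
              (placement-embedding ca≢cv (pairClique a≢b ca≡cb (size≤2 (c a))) V)
              (inside refl refl) (inside refl refl) small-2-2-removed)

      touchingEigenpair : ∀ {a b u v} → a ≢ b → c a ≡ c b → c u ≡ c a → c u ≢ c v → LargeEigenpair c a b u v m
      touchingEigenpair a≢b ca≡cb cu≡ca cu≢cv
        with pairClique-complete (pairClique a≢b ca≡cb (size≤2 _)) cu≡ca
      ... | inj₁ refl = detachedEigenpair a≢b ca≡cb cu≢cv
      ... | inj₂ refl = swap-removed (detachedEigenpair (≢-sym a≢b) (sym ca≡cb) cu≢cv)

      -- A clique that loses ab has just the vertices a and b, so an end of uv inside it must be a
      -- or b; the two ends cannot both lie there.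
      joinEigenpair-≤2 : ∀ {a b u v} → c a ≡ c b → c u ≢ c v → LargeEigenpair c a b u v m
      joinEigenpair-≤2 {a} {b} {u} {v} ca≡cb cu≢cv with a ≟ b | c u ≟ c a | c v ≟ c a
      ... | yes a≡b | _         | _         = inactiveEigenpair cu≢cv (inj₁ a≡b)
      ... | no a≢b  | yes cu≡ca | _         = touchingEigenpair a≢b ca≡cb cu≡ca cu≢cv
      ... | no a≢b  | no _      | yes cv≡ca = swap-added (touchingEigenpair a≢b ca≡cb cv≡ca (≢-sym cu≢cv))
      ... | no _    | no cu≢ca  | no cv≢ca  = inactiveEigenpair cu≢cv (inj₂ (ca≡cb , ≢-sym cu≢ca , ≢-sym cv≢ca))

    module _ {D} (size≡m : size D ≡ m) (2<m : 2 ℕ.< m) where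

      k<size : ∀ {k} → k ℕ.< m → k ℕ.< size D
      k<size {k} = subst (k ℕ.<_) (sym size≡m)

      -- At least three vertices of D leave two different from u. Their twin vector vanishes at u,
      -- and at v because v lies outside D.
      untouchedEigenpair : ∀ {a b u v} → a ≡ b ⊎ (c a ≢ D × c b ≢ D) → c v ≢ D → LargeEigenpair c a b u v m
      untouchedEigenpair {a} {b} {u} {v} ab cv≢D
        with x , z , x≢z , cx≡D , cz≡D , x≢u ∷ [] , z≢u ∷ [] ← pairAvoiding D (u ∷ []) (k<size 2<m)
        = twinEigenpair size≡m x≢z cx≡D cz≡D
          ([ cong (twins x z) , (λ (ca≢D , cb≢D) → trans (twins-off (apart cx≡D ca≢D) (apart cz≡D ca≢D))
            (sym (twins-off (apart cx≡D cb≢D) (apart cz≡D cb≢D)))) ]′ ab)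
          (trans (twins-off x≢u z≢u) (sym (twins-off (apart cx≡D cv≢D) (apart cz≡D cv≢D))))

      module _ {a b} (a≢b : a ≢ b) (ca≡D : c a ≡ D) (cb≡D : c b ≡ D) where

        tripleClique : ∀ {z} → m ℕ.≤ 3 → c z ≡ D → z ≢ a → z ≢ b → Enumerates c D (a ∷ b ∷ z ∷ [])
        tripleClique m≤3 cz≡D z≢a z≢b = enumerate c D
          ((a≢b ∷ ≢-sym z≢a ∷ []) ∷ (≢-sym z≢b ∷ []) ∷ [] ∷ [])
          (ca≡D ∷ cb≡D ∷ cz≡D ∷ []) (subst (ℕ._≤ 3) (sym size≡m) m≤3)

        pendantEigenpair : ∀ {v} → m ℕ.≤ 3 → c v ≢ D → size (c v) ℕ.≤ 2 → LargeEigenpair c a b a v m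
        pendantEigenpair {v} m≤3 cv≢D size-v≤2
          with z , cz≡D , z≢a ∷ z≢b ∷ [] ← another c D (a ∷ b ∷ []) (k<size 2<m)
          with cliqueAround v size-v≤2
        ... | inj₁ V       = weaken m≤3 (embedEigenpair
                (placement-embedding (≢-sym cv≢D) (tripleClique m≤3 cz≡D z≢a z≢b) V)
                (inside refl refl) (inside refl refl) path₄)
        ... | inj₂ (_ , V) = weaken m≤3 (embedEigenpair
                (placement-embedding (≢-sym cv≢D) (tripleClique m≤3 cz≡D z≢a z≢b) V)
                (inside refl refl) (inside refl refl) path₅)

        centralEigenpair : ∀ {u v} → m ℕ.≤ 3 → c u ≡ D → u ≢ a → u ≢ b → c v ≢ D → size (c v) ℕ.≤ 2 →
          LargeEigenpair c a b u v m
        centralEigenpair {u} {v} m≤3 cu≡D u≢a u≢b cv≢D size-v≤2 with cliqueAround v size-v≤2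
        ... | inj₁ V       = weaken (ℕ.m≤n⇒m≤1+n m≤3) (embedEigenpair
                (placement-embedding (≢-sym cv≢D) (tripleClique m≤3 cu≡D u≢a u≢b) V)
                (inside refl refl) (inside refl refl) star)
        ... | inj₂ (_ , V) = weaken m≤3 (embedEigenpair
                (placement-embedding (≢-sym cv≢D) (tripleClique m≤3 cu≡D u≢a u≢b) V)
                (inside refl refl) (inside refl refl) spider)

        anchoredEigenpair : ∀ {u v} → 3 ℕ.< m → u ≡ a ⊎ u ≡ b → c v ≢ D → LargeEigenpair c a b u v m
        anchoredEigenpair {u} {v} 3<m u∈ab cv≢D
          with x , z , x≢z , cx≡D , cz≡D , x≢a ∷ x≢b ∷ [] , z≢a ∷ z≢b ∷ [] ← pairAvoiding D (a ∷ b ∷ []) (k<size 3<m)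
          = twinEigenpair size≡m x≢z cx≡D cz≡D
            (trans (twins-off x≢a z≢a) (sym (twins-off x≢b z≢b)))
            (trans ([ (λ { refl → twins-off x≢a z≢a }) , (λ { refl → twins-off x≢b z≢b }) ]′ u∈ab)
              (sym (twins-off (apart cx≡D cv≢D) (apart cz≡D cv≢D))))

        -- The fourth vertex of D lets the fork vector avoid u; if u is a or b, two further vertices
        -- of D form twins instead.
        cutEigenpair-≥4 : ∀ {u v} → 3 ℕ.< m → c v ≢ D → LargeEigenpair c a b u v m
        cutEigenpair-≥4 {u} {v} 3<m cv≢D with u ≟ a | u ≟ b
        ... | no u≢a | no u≢b
          with z , cz≡D , z≢a ∷ z≢b ∷ z≢u ∷ [] ← another c D (a ∷ b ∷ u ∷ []) (k<size 3<m)
          = forkEigenpair size≡m a≢b ca≡D cb≡D cz≡D z≢a z≢b (inj₁ λ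
              { (inj₁ refl) → u≢a , u≢b , ≢-sym z≢u
              ; (inj₂ refl) → ≢-sym (apart ca≡D cv≢D) , ≢-sym (apart cb≡D cv≢D) , ≢-sym (apart cz≡D cv≢D) })
        ... | yes u≡a  | _        = anchoredEigenpair 3<m (inj₁ u≡a) cv≢D
        ... | no _     | yes u≡b  = anchoredEigenpair 3<m (inj₂ u≡b) cv≢D

      -- D has only a, b and one more vertex, so the fork vector is non-zero on all of D and is
      -- available exactly when u lies outside D.
      cutEigenpair-≤3 : ∀ {a b u v} → a ≢ b → c a ≡ D → c b ≡ D → m ℕ.≤ 3 → c v ≢ D → size (c v) ℕ.≤ 2 →
        LargeEigenpair c a b u v m
      cutEigenpair-≤3 {a} {b} {u} {v} a≢b ca≡D cb≡D m≤3 cv≢D size-v≤2 with u ≟ a | u ≟ b | c u ≟ D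
      ... | yes refl | _        | _        = pendantEigenpair a≢b ca≡D cb≡D m≤3 cv≢D size-v≤2
      ... | no _     | yes refl | _        = swap-removed (pendantEigenpair (≢-sym a≢b) cb≡D ca≡D m≤3 cv≢D size-v≤2)
      ... | no u≢a   | no u≢b   | yes cu≡D = centralEigenpair a≢b ca≡D cb≡D m≤3 cu≡D u≢a u≢b cv≢D size-v≤2
      ... | no u≢a   | no u≢b   | no cu≢D
        with z , cz≡D , z≢a ∷ z≢b ∷ [] ← another c D (a ∷ b ∷ []) (k<size 2<m)
        = forkEigenpair size≡m a≢b ca≡D cb≡D cz≡D z≢a z≢b (inj₁ λ
            { (inj₁ refl) → u≢a , u≢b , ≢-sym (apart cz≡D cu≢D)
            ; (inj₂ refl) → ≢-sym (apart ca≡D cv≢D) , ≢-sym (apart cb≡D cv≢D) , ≢-sym (apart cz≡D cv≢D) })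

    -- If m = 3 and the clique of v also has size 3, that clique contains none of a, b, u and can
    -- replace D. This confines the special components to a clique of v of size at most 2.
    cutEigenpair : ∀ {D} → size D ≡ m → 2 ℕ.< m → ∀ {a b u v} → a ≢ b → c a ≡ D → c b ≡ D →
      c u ≢ c v → c v ≢ D → LargeEigenpair c a b u v m
    cutEigenpair size≡m 2<m {v = v} a≢b ca≡D cb≡D cu≢cv cv≢D with m ℕ.≤? 3 | size (c v) ℕ.≤? 2
    ... | no m≰3  | _          = cutEigenpair-≥4 size≡m 2<m a≢b ca≡D cb≡D (ℕ.≰⇒> m≰3) cv≢D
    ... | yes m≤3 | yes size≤2 = cutEigenpair-≤3 size≡m 2<m a≢b ca≡D cb≡D m≤3 cv≢D size≤2
    ... | yes m≤3 | no size≰2  = swap-added (untouchedEigenpair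
      (ℕ.≤-antisym (size≤m (c v)) (ℕ.≤-trans m≤3 (ℕ.≰⇒> size≰2))) 2<m
      (inj₂ ((λ ca≡cv → cv≢D (trans (sym ca≡cv) ca≡D)) , (λ cb≡cv → cv≢D (trans (sym cb≡cv) cb≡D)))) cu≢cv)

    joinEigenpair-≥3 : ∀ {D} → size D ≡ m → 2 ℕ.< m → ∀ {a b u v} → c a ≡ c b →
      c u ≢ c v → c v ≢ D → LargeEigenpair c a b u v m
    joinEigenpair-≥3 {D} size≡m 2<m {a} {b} ca≡cb cu≢cv cv≢D with a ≟ b | c a ≟ D
    ... | yes a≡b | _        = untouchedEigenpair size≡m 2<m (inj₁ a≡b) cv≢D
    ... | no _    | no ca≢D  = untouchedEigenpair size≡m 2<m (inj₂ (ca≢D , ca≢D ∘ trans ca≡cb)) cv≢D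
    ... | no a≢b  | yes ca≡D = cutEigenpair size≡m 2<m a≢b ca≡D (trans (sym ca≡cb) ca≡D) cu≢cv cv≢D

    -- As u and v lie in different cliques, one of them is outside D; swapping makes it v.
    joinEigenpair : ∀ {D} → size D ≡ m → ∀ {a b u v} → c a ≡ c b → c u ≢ c v → LargeEigenpair c a b u v m
    joinEigenpair {D} size≡m {v = v} ca≡cb cu≢cv with m ℕ.≤? 2 | c v ≟ D
    ... | yes m≤2 | _        = joinEigenpair-≤2 m≤2 ca≡cb cu≢cv
    ... | no m≰2  | no cv≢D  = joinEigenpair-≥3 size≡m (ℕ.≰⇒> m≰2) ca≡cb cu≢cv cv≢D
    ... | no m≰2  | yes cv≡D = swap-added (joinEigenpair-≥3 size≡m (ℕ.≰⇒> m≰2) ca≡cb (≢-sym cu≢cv)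
      (λ cu≡D → cu≢cv (trans cu≡D (sym cv≡D))))

-- Edge counts and the theorem

∣tabulate∣-cong : ∀ {n} {P Q : Fin n → Bool} → (∀ i → P i ≡ Q i) → ∣ tabulate P ∣ ≡ ∣ tabulate Q ∣
∣tabulate∣-cong P≗Q = cong ∣_∣ (Vec.tabulate-cong P≗Q)

∣tabulate-false∣≡0 : ∀ n → ∣ tabulate {n = n} (const false) ∣ ≡ 0
∣tabulate-false∣≡0 ℕ.zero    = refl
∣tabulate-false∣≡0 (ℕ.suc n) = ∣tabulate-false∣≡0 n

∣tabulate-≟∣≡1 : ∀ {n} (b : Fin n) → ∣ tabulate (λ v → does (v ≟ b)) ∣ ≡ 1
∣tabulate-≟∣≡1 {ℕ.suc n} zero    = cong ℕ.suc (∣tabulate-false∣≡0 n)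
∣tabulate-≟∣≡1 {ℕ.suc n} (suc b) = ∣tabulate-≟∣≡1 b

sumℕ-cong : ∀ {n} {f g : Fin n → ℕ} → (∀ i → f i ≡ g i) → sumℕ f ≡ sumℕ g
sumℕ-cong {ℕ.zero}  f≗g = refl
sumℕ-cong {ℕ.suc n} f≗g = cong₂ ℕ._+_ (f≗g zero) (sumℕ-cong (f≗g ∘ suc))

sumℕ-0 : ∀ n → sumℕ {n} (const 0) ≡ 0
sumℕ-0 ℕ.zero    = refl
sumℕ-0 (ℕ.suc n) = sumℕ-0 n

sumℕ-≟ : ∀ {n} (a : Fin n) → sumℕ (λ u → if does (u ≟ a) then 1 else 0) ≡ 1
sumℕ-≟ {ℕ.suc n} zero    = cong ℕ.suc (sumℕ-0 n)
sumℕ-≟ {ℕ.suc n} (suc a) = sumℕ-≟ a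

module _ {n} (G : Graph n) where
  private module G = Graph G

  edgeless : (∀ u v → ¬ u G.~ v) → edgeCount G ≡ 0
  edgeless none = trans (sumℕ-cong (λ u → trans
      (∣tabulate∣-cong (λ v → trans (cong (does (u Fin.<? v) ∧_) (dec-false (u G.~? v) (none u v)))
                                    (∧-zeroʳ (does (u Fin.<? v)))))
      (∣tabulate-false∣≡0 n)))
    (sumℕ-0 n)

  -- Counting at the smaller end leaves (a , b) as the one counted pair, so the indicator factors
  -- into two point masses.
  singleEdge-< : ∀ {a b} → a Fin.< b → a G.~ b → (∀ u v → u G.~ v → SamePair a b u v) → edgeCount G ≡ 1
  singleEdge-< {a} {b} a<b a~b only = trans (sumℕ-cong row) (sumℕ-≟ a)
    where
    entry : ∀ u v → does (u Fin.<? v) ∧ does (u G.~? v) ≡ does (u ≟ a) ∧ does (v ≟ b)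
    entry u v = does-⇔ (mk⇔
        (λ (u<v , u~v) → [ (λ p → p) , (λ { (refl , refl) → contradiction u<v (Fin.<-asym a<b) }) ]′ (only u v u~v))
        (λ { (refl , refl) → a<b , a~b }))
      (u Fin.<? v ×-dec u G.~? v) (u ≟ a ×-dec v ≟ b)
    row : ∀ u → ∣ tabulate (λ v → does (u Fin.<? v) ∧ does (u G.~? v)) ∣ ≡ (if does (u ≟ a) then 1 else 0)
    row u with u ≟ a | ∣tabulate∣-cong (entry u)
    ... | yes _ | eq = trans eq (∣tabulate-≟∣≡1 b)
    ... | no  _ | eq = trans eq (∣tabulate-false∣≡0 n)

  singleEdge : ∀ {a b} → a G.~ b → (∀ u v → u G.~ v → SamePair a b u v) → edgeCount G ≡ 1
  singleEdge {a} {b} a~b only with Fin.<-cmp a b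
  ... | tri< a<b _ _ = singleEdge-< a<b a~b only
  ... | tri≈ _ a≡b _ = contradiction a~b (G.~-irrefl a≡b)
  ... | tri> _ _ b<a = singleEdge-< b<a (G.~-sym a~b) (λ u v u~v → Sum.swap (only u v u~v))

  secondEdge : ∀ {a b} → edgeCount G ≢ 1 → a G.~ b → ∃ λ x → ∃ λ z → x G.~ z × ¬ SamePair a b x z
  secondEdge {a} {b} edges≢1 a~b with any? (λ x → any? λ z → x G.~? z ×-dec ¬? (samePair? a b x z))
  ... | yes found = found
  ... | no  none  = contradiction (singleEdge a~b only) edges≢1
    where
    only : ∀ u v → u G.~ v → SamePair a b u v
    only u v u~v with samePair? a b u v
    ... | yes sp  = sp
    ... | no  ¬sp = contradiction (u , v , u~v , ¬sp) none

-- The argument in `Fin p` excludes p = 0, where the maximum is 0 and no class attains it.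
largestClass : ∀ {n p} (c : Fin n → Fin p) → Fin p → ∃ λ D → componentSize c D ≡ maximum (componentSize c)
largestClass {p = ℕ.suc p} c _ = maximum-attained p (componentSize c)

-- From eigenpairs back to graphs

module _ {n p} {c : Fin n → Fin p} {a b u v : Fin n} {H : Graph n}
         (ca≡cb : c a ≡ c b) (joins : Joins c u v) (surgery : IsSurgery c a b u v H) where

  surgeryEigenvalue : ∀ {m} (e : LargeEigenpair c a b u v m) →
    IsEigenvalue (laplacian H) (LargeEigenpair.value e)
  surgeryEigenvalue (largeEigenpair μ w (i , wi≄0) eigen _) =
    w , (λ w≃0 → wi≄0 (w≃0 i)) ,
    λ j → Null-cong (λ k → cong (_- seq μ k * seq (w j) k)
      (sym (seq-laplacian-surgery {H = H} ca≡cb joins surgery w j k))) (eigen j)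

module _ {n p} (G : Graph n) {c : Fin n → Fin p} (disjoint : IsDisjointUnionOfCompletes G c) where
  private
    module G = Graph G

    m : ℕ
    m = maximum (componentSize c)

    size≤m : ∀ D → componentSize c D ℕ.≤ m
    size≤m = ≤-maximum (componentSize c)

    clique⁻ : ∀ {x y} → x G.~ y → x ≢ y × c x ≡ c y
    clique⁻ {x} {y} = Equivalence.to (proj₂ disjoint x y)

    clique⁺ : ∀ {x y} → x ≢ y → c x ≡ c y → x G.~ y
    clique⁺ {x} {y} x≢y cx≡cy = Equivalence.from (proj₂ disjoint x y) (x≢y , cx≡cy)

    samePair-≢ : ∀ {u v x y : Fin n} → u ≢ v → SamePair u v x y → x ≢ y
    samePair-≢ u≢v (inj₁ (refl , refl)) = u≢v
    samePair-≢ u≢v (inj₂ (refl , refl)) = ≢-sym u≢v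

    samePair-≡ : ∀ {u x y : Fin n} → SamePair u u x y → x ≡ y
    samePair-≡ (inj₁ (refl , refl)) = refl
    samePair-≡ (inj₂ (refl , refl)) = refl

  -- The chain is μ ≤ m ≤ value ≤ ν: its last step is the maximality of ν, applied to the
  -- constructed eigenvalue of H.
  λ₁≤-surgery : ∀ {a b u v} {H : Graph n} → c a ≡ c b → Joins c u v → IsSurgery c a b u v H →
    LargeEigenpair c a b u v m → G λ₁≤ H
  λ₁≤-surgery {H = H} ca≡cb joins surgery e μ ν (μ-eigen , _) (_ , ν-largest) =
    ≤ᵣ-trans {μ} {fromℤ (+ m)} {ν} (eigenvalue-≤ G disjoint m size≤m μ μ-eigen)
      (≤ᵣ-trans {fromℤ (+ m)} {LargeEigenpair.value e} {ν} (LargeEigenpair.large e)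
        (ν-largest (LargeEigenpair.value e) (surgeryEigenvalue {H = H} ca≡cb joins surgery e)))

  λ₁≤-join : ∀ {a b u v} {H : Graph n} → c a ≡ c b → c u ≢ c v → IsSurgery c a b u v H → G λ₁≤ H
  λ₁≤-join {u = u} {H = H} ca≡cb cu≢cv surgery = λ₁≤-surgery {H = H} ca≡cb (inj₂ cu≢cv) surgery
    (joinEigenpair c m size≤m (proj₂ (largestClass c (c u))) ca≡cb cu≢cv)

  λ₁≤-reconnect : ∀ H → OneEdgeReconnect G H → G λ₁≤ H
  λ₁≤-reconnect H (a , b , u , v , a~b , u≢v , u≁v , H⇔) =
    λ₁≤-join {H = H} (proj₂ (clique⁻ a~b)) (u≁v ∘ clique⁺ u≢v) surgery
    where
    surgery : IsSurgery c a b u v H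
    surgery x y = mk⇔
      (λ x~y → [ (λ (x~Gy , ¬sp) → let x≢y , cx≡cy = clique⁻ x~Gy in x≢y , inj₁ (cx≡cy , ¬sp))
               , (λ sp → samePair-≢ u≢v sp , inj₂ sp) ]′ (Equivalence.to (H⇔ x y) x~y))
      λ (x≢y , cases) → Equivalence.from (H⇔ x y)
        (Sum.map₁ (λ (cx≡cy , ¬sp) → clique⁺ x≢y cx≡cy , ¬sp) cases)

  λ₁≤-addition : ∀ H → OneEdgeAddition G H → G λ₁≤ H
  λ₁≤-addition H (u , v , u≢v , u≁v , H⇔) = λ₁≤-join {a = u} {H = H} refl (u≁v ∘ clique⁺ u≢v) surgery
    where
    surgery : IsSurgery c u u u v H
    surgery x y = mk⇔
      (λ x~y → [ (λ x~Gy → let x≢y , cx≡cy = clique⁻ x~Gy in x≢y , inj₁ (cx≡cy , x≢y ∘ samePair-≡))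
               , (λ sp → samePair-≢ u≢v sp , inj₂ sp) ]′ (Equivalence.to (H⇔ x y) x~y))
      λ (x≢y , cases) → Equivalence.from (H⇔ x y)
        (Sum.map₁ (λ (cx≡cy , _) → clique⁺ x≢y cx≡cy) cases)

  -- A single edge is a true exception: there m = 2, and deleting the edge leaves the zero
  -- Laplacian.
  λ₁≤-removal : edgeCount G ≢ 1 → ∀ H → OneEdgeRemoval G H → G λ₁≤ H
  λ₁≤-removal edges≢1 H (a , b , a~b , H⇔)
    with a≢b , ca≡cb ← clique⁻ a~b
    with x , z , x~z , ¬sp ← secondEdge G edges≢1 a~b
    with x≢z , cx≡cz ← clique⁻ x~z
    with D , size≡m ← largestClass c (c a)
    = λ₁≤-surgery {H = H} ca≡cb (inj₁ refl) surgery
        (removalEigenpair c m size≤m a D size≡m a≢b ca≡cb x≢z cx≡cz ¬sp)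
    where
    surgery : IsSurgery c a b a a H
    surgery x y = mk⇔
      (λ x~y → let x~Gy , ¬sp = Equivalence.to (H⇔ x y) x~y
                   x≢y , cx≡cy = clique⁻ x~Gy in x≢y , inj₁ (cx≡cy , ¬sp))
      λ { (x≢y , inj₁ (cx≡cy , ¬sp)) → Equivalence.from (H⇔ x y) (clique⁺ x≢y cx≡cy , ¬sp)
        ; (x≢y , inj₂ sp)            → contradiction (samePair-≡ sp) x≢y }

  -- An edge forces m ≥ 2, so a largest clique has two vertices for a twin vector. Without edges 0
  -- is the only possible eigenvalue, while m = 1 as soon as there is a vertex.
  largestCliqueEigenvalue : edgeCount G ≢ 0 → IsEigenvalue (laplacian G) (fromℤ (+ m))
  largestCliqueEigenvalue edges≢0 with any? (λ x → any? λ z → x G.~? z)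
  ... | no none = contradiction (edgeless G (λ x z x~z → none (x , z , x~z))) edges≢0
  ... | yes (x , z , x~z)
    with x≢z , cx≡cz ← clique⁻ x~z
    with D , size≡m ← largestClass c (c x)
    with y , t , y≢t , refl , ct≡D , _ ← pairAvoiding c m D [] (ℕ.≤-trans
           (length≤componentSize c (c x) ((x≢z ∷ []) ∷ [] ∷ []) (refl ∷ sym cx≡cz ∷ []))
           (ℕ.≤-trans (size≤m (c x)) (ℕ.≤-reflexive (sym size≡m))))
    = surgeryEigenvalue {H = G} refl (inj₁ refl) (trivialSurgery G disjoint y)
        (twinEigenpair c m size≡m y≢t refl ct≡D refl refl)

theorem3p6 : ∀ (n p : ℕ) (G : Graph n) (c : Fin n → Fin p) →
    IsDisjointUnionOfCompletes G c →
    LELM G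
    × (edgeCount G ≢ 1 → ∀ H → OneEdgeRemoval G H → G λ₁≤ H)
    × (edgeCount G ≢ 0 → Isλ₁ G (fromℤ (+ maximum (componentSize c))))
theorem3p6 n p G c disjoint =
  (λ H → [ λ₁≤-reconnect G disjoint H , λ₁≤-addition G disjoint H ]′) ,
  λ₁≤-removal G disjoint ,
  λ edges≢0 → largestCliqueEigenvalue G disjoint edges≢0 ,
    eigenvalue-≤ G disjoint (maximum (componentSize c)) (≤-maximum (componentSize c))
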